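{- Let $(R_1,\mathcal L_1)$ and $(R_2,\mathcal L_2)$ be sets with a finite language. Suppose that Hilbert's tenth problem exists over $(R_1,\mathcal L_1)$ and over $(R_2,\mathcal L_2)$. Let $d:R_1\to R_2$ be an injective map. Suppose that for each of the following sets: (1) for all constants $c\in\mathcal L_1$, the set $\{d(c)\}$; (2) for all functions $f:R_1^k\to R_1$ of $\mathcal L_1$, the set $\{(d(x_1),\ldots,d(x_k),d(f(x_1,\ldots,x_k)))\mid\vec x\in R_1^k\}$; (3) for all relations $S\subset R_1^k$ of $\mathcal L_1$, the set $d(S)$; (4) the set $d(R_1)$, an explicit description of the form $$\{\vec x\in R_2^k\mid\exists\vec y\in R_2^l,\ \forall 1\le i\le n,\ (t_{i1}(\vec x,\vec y),\ldots,t_{in_i}(\vec x,\vec y))\in S_i\}$$ with $t_{ij}$ terms of $\mathcal L_2$ and $S_i$ relations of $\mathcal L_2$ is known. Then $d$ is an effective Diophantine map.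
   Context: $\mathbb N=\mathbb Z_{\ge0}$. A "set with a language" $(R,\mathcal L)$ is a set $R$ together with a language $\mathcal L$ (constants, functions, relations) with an interpretation in $R$; every language contains a constant $0$ and equality. Terms are built from constants of $\mathcal L$ and variables using functions of $\mathcal L$; basic formulas have the form $(t_1,\ldots,t_k)\in R'$ with $R'\in\mathcal L$ a $k$-ary relation (possibly equality) and $t_i$ terms. $S\subset R^k$ is Diophantine if $S=\{\vec x\in R^k\mid\exists\vec y\in R^l\ (f_1\wedge\cdots\wedge f_r)\}$ for some basic formulas $f_i$. $d(S)$ denotes coordinatewise image. $d:R_1\to R_2$ is a Diophantine map if $d(S)$ is Diophantine for all $k$ and all Diophantine $S\subset R_1^k$. Existence of Hilbert's tenth problem. $S_c(\mathcal L)$ is the set of constants of $\mathcal L$ and $S_c'(\mathcal L)=\{x\in R\mid\{x\}\text{ is Diophantine}\}$. A recursive ring is a ring with a recursive representation, i.e. an injection $j$ into $\mathbb N$ with recursive image for which addition and multiplication are recursive. A recursive ring $R_0$ with $S_c(\mathcal L)\subset R_0\subset S_c'(\mathcal L)$ is compatible with $(R,\mathcal L)$ if, for the language $\mathcal L'$ on $R_0$ having each constant $c\in\mathcal L$, the relation $S_f\cap R_0^{r+1}$ for each $r$-ary function $f\in\mathcal L$ (with $S_f=\{(\vec x,f(\vec x))\mid\vec x\in R^r\}$) and $S\cap R_0^r$ for each $r$-ary relation $S\in\mathcal L$, one has $S_c'(\mathcal L')=R_0$ and all relations of $\mathcal L'$ are recursive in $R_0$. Hilbert's tenth problem exists over $(R,\mathcal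 L)$ if $\mathcal L$ is countable and a compatible recursive ring $R_0$ with $S_c(\mathcal L)\subset R_0\subset S_c'(\mathcal L)$ exists. Coding. Let $R_i'$ be such a ring for $(R_i,\mathcal L_i)$ with representation $j_i$. For $(R,\mathcal L)=(R_i,\mathcal L_i)$, number the constants and functions injectively by $\mathrm{num}_{\mathcal L}$; put $\mathrm{sym}(l)=2^{\mathrm{num}_{\mathcal L}(l)}$ for constants and functions $l$, $\mathrm{sym}(x_n)=3^n$ for variables $x_n$, $\mathrm{sym}(r)=5^{j_i(r)}$ for $r\in R_i'$ (indices chosen so that different symbols get different codes). A term written in bracket-free prefix form as a string $s_1\cdots s_n$ gets number $J_i(s_1\cdots s_n)=\prod_m p_m^{\mathrm{sym}(s_m)}$, $p_m$ the $m$-th prime. Standing convention for this result: only the constants of $\mathcal L_i$ (not other elements of $R_i'$ or $S_c'(\mathcal L_i)$) are used as constants in terms and formulas. The relations of $\mathcal L_i$ (including equality) are numbered by natural numbers, and a finite system $(t_{11},\ldots)\in S_{i_1},\ldots,(t_{l1},\ldots)\in S_{i_l}$ is coded by the tuple $(l,i_1,J_i(t_{11}),\ldots,i_l,J_i(t_{l1}),\ldots)\in\bigcup_{n\ge0}\mathbb N^n$. Effective. A Diophantine map $d:R_1\to R_2$ is effective if there is a recursive function $D:\bigcup_{n\ge0}\mathbb N^n\to\bigcup_{n\ge0}\mathbb N^n$ that sends the code of every system $T$ of Diophantine equations in $\mathcal L_1$ (in variables $\vec x$) to the code of a system $D(T)$ in $\mathcal L_2$ (in variables $(\vec z,\vec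 y)$, $\vec z$ of the same length as $\vec x$) such that: (i) if $\vec x$ is a solution of $T$ over $R_1$, there is $\vec y$ such that $(d(\vec x),\vec y)$ is a solution of $D(T)$ over $R_2$; (ii) if $(\vec z,\vec y)$ is a solution of $D(T)$ over $R_2$, there is a solution $\vec x$ of $T$ with $\vec z=d(\vec x)$. -}

module Defs where

open import Algebra.Structures using (IsRing)
open import Data.Empty using (⊥)
open import Data.Fin using (Fin; toℕ)
open import Data.List using (List; []; _∷_; _++_; length; map; concatMap)
open import Data.List.Relation.Unary.All using (All)
open import Data.List.Relation.Unary.Any using (Any)
open import Data.Nat using (ℕ; zero; suc; _+_; _*_; _^_; _≤_; _<_; _!; s≤s; z≤n)
open import Data.Nat.Divisibility using (_∣_; ∣m+n∣m⇒∣n; ∣-trans; m≤n⇒m!∣n!; m∣m*n; ∣1⇒≡1)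
open import Data.Nat.ListAction using (product)
open import Data.Nat.Primality using (Prime; prime?; ¬prime[1]; prime⇒nonTrivial)
open import Data.Nat.Primality.Factorisation using (factorise)
open import Data.Nat.Properties
  using (≤-refl; ≤-trans; ≤-antisym; m≤n⇒m<n∨m≡n; +-comm; 1≤n!; n≤1+n; m≤m+n; +-suc; ≰⇒>)
open import Data.Product using (Σ; ∃; _×_; _,_; proj₁; proj₂)
open import Data.Sum using (_⊎_; inj₁; inj₂)
open import Data.Vec as Vec using (Vec; []; _∷_; _∷ʳ_; head; tail; lookup; tabulate; toList)
open import Data.Vec.Relation.Unary.Any using () renaming (Any to VecAny)
open import Function.Bundles using (_↣_; _↔_; _⇔_; Injection; Equivalence)
open import Function.Definitions using (Injective)
open import Level using (0ℓ)
open import Relation.Binary.PropositionalEquality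
  using (_≡_; _≢_; _≗_; refl; sym; trans; cong; subst)
open import Relation.Nullary using (¬_; yes; no; contradiction)
open import Relation.Unary using (Pred; _≐_)

private
  prime-above : ∀ n → ∃ λ p → n < p × Prime p
  prime-above n with factorise (suc (n !))
  ... | record { factors = [] ; isFactorisation = eq } =
    contradiction (subst (2 ≤_) eq (s≤s (1≤n! n))) λ { (s≤s ()) }
  ... | record { factors = p ∷ ps ; isFactorisation = eq
               ; factorsPrime = pr All.∷ _ } = p , ≰⇒> p≰n , pr
    where
    p∣ : p ∣ n ! + 1
    p∣ = subst (p ∣_) (trans (sym eq) (+-comm 1 (n !))) (m∣m*n (product ps))
    p∣p! : ∀ q → 1 ≤ q → q ∣ q !
    p∣p! (suc q) _ = m∣m*n (q !)
    1≤prime : ∀ {q} → Prime q → 1 ≤ q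
    1≤prime {zero}  pq = contradiction (prime⇒nonTrivial pq) λ ()
    1≤prime {suc _} pq = s≤s z≤n
    p≰n : ¬ p ≤ n
    p≰n p≤n = ¬prime[1] (subst Prime
      (∣1⇒≡1 (∣m+n∣m⇒∣n p∣ (∣-trans (p∣p! p (1≤prime pr)) (m≤n⇒m!∣n! p≤n)))) pr)

  not-at : ∀ {n} → ¬ Prime n → ∀ q → n ≤ q → Prime q → n < q
  not-at ¬pr q n≤q pq with m≤n⇒m<n∨m≡n n≤q
  ... | inj₁ n<q  = n<q
  ... | inj₂ refl = contradiction pq ¬pr

  least-prime : ∀ fuel n → (∃ λ p → n ≤ p × p ≤ n + fuel × Prime p) →
                ∃ λ p → n ≤ p × Prime p × (∀ q → n ≤ q → Prime q → p ≤ q)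
  least-prime fuel n ex with prime? n
  ... | yes pr = n , ≤-refl , pr , λ q n≤q _ → n≤q
  least-prime zero n (p , n≤p , p≤n , pr) | no ¬pr =
    contradiction (subst Prime (≤-antisym (subst (p ≤_) (+-comm n 0) p≤n) n≤p) pr) ¬pr
  least-prime (suc fuel) n (p , n≤p , p≤b , pr) | no ¬pr =
    let r , n<r , pr′ , least = least-prime fuel (suc n)
          (p , not-at ¬pr p n≤p pr , subst (p ≤_) (+-suc n fuel) p≤b , pr)
    in r , ≤-trans (n≤1+n n) n<r , pr′ , λ q n≤q pq → least q (not-at ¬pr q n≤q pq) pq

nextPrime : ∀ n → ∃ λ p → n < p × Prime p × (∀ q → n < q → Prime q → p ≤ q)
nextPrime n =
  let p , n<p , pr = prime-above n
  in least-prime p (suc n) (p , n<p , subst (p ≤_) (+-comm p (suc n)) (m≤m+n p (suc n)) , pr)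

-- Indexed from 0: nthPrime 0 is 2.
nthPrime : ℕ → ℕ
nthPrime zero    = proj₁ (nextPrime 0)
nthPrime (suc m) = proj₁ (nextPrime (nthPrime m))

-- primePowers m (s₁ ∷ … ∷ sₙ ∷ []) = p_m ^ s₁ * … * p_{m+n-1} ^ sₙ
primePowers : ℕ → List ℕ → ℕ
primePowers m []       = 1
primePowers m (s ∷ ss) = nthPrime m ^ s * primePowers (suc m) ss

primRec : ∀ {n} → (Vec ℕ n → ℕ) → (Vec ℕ (2 + n) → ℕ) → ℕ → Vec ℕ n → ℕ
primRec g h zero    v = g v
primRec g h (suc x) v = h (x ∷ primRec g h x v ∷ v)

-- The total recursive functions: the least class of number-theoretic
-- functions containing the initial functions and closed under composition,
-- primitive recursion and minimisation of functions that always have a zero.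
-- Functions are identified when they are pointwise equal (ext).
data Recursive : ∀ {n} → (Vec ℕ n → ℕ) → Set where
  zeroʳ : ∀ {n} → Recursive {n} (λ _ → 0)
  sucʳ  : Recursive {1} (λ v → suc (head v))
  projʳ : ∀ {n} (i : Fin n) → Recursive (λ v → lookup v i)
  compʳ : ∀ {m n} {g : Vec ℕ m → ℕ} {h : Fin m → Vec ℕ n → ℕ} →
          Recursive g → (∀ i → Recursive (h i)) →
          Recursive (λ v → g (tabulate (λ i → h i v)))
  precʳ : ∀ {n} {g : Vec ℕ n → ℕ} {h : Vec ℕ (2 + n) → ℕ} →
          Recursive g → Recursive h →
          Recursive {suc n} (λ v → primRec g h (head v) (tail v))
  minʳ  : ∀ {n} {g : Vec ℕ (suc n) → ℕ} {f : Vec ℕ n → ℕ} →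
          Recursive g →
          (∀ v → g (f v ∷ v) ≡ 0) →
          (∀ v m → m < f v → g (m ∷ v) ≢ 0) →
          Recursive f
  ext   : ∀ {n} {f g : Vec ℕ n → ℕ} → f ≗ g → Recursive f → Recursive g

RecursiveSet : ∀ {n} → Pred (Vec ℕ n) 0ℓ → Set
RecursiveSet {n} S = ∃ λ (χ : Vec ℕ n → ℕ) → Recursive χ ×
  (∀ v → (S v × χ v ≡ 1) ⊎ (¬ S v × χ v ≡ 0))

-- Gödel numbers of finite sequences, a₁ … aₙ ↦ ∏ pₘ ^ (1 + aₘ); adding 1 to
-- the exponents makes trailing zeros visible.
seqCode : List ℕ → ℕ
seqCode as = primePowers 0 (map suc as)

RecursiveOnLists : (List ℕ → List ℕ) → Set
RecursiveOnLists D = ∃ λ (f : Vec ℕ 1 → ℕ) → Recursive f ×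
  (∀ as → f (seqCode as ∷ []) ≡ seqCode (D as))

record Language (R : Set) : Set₁ where
  field
    Con : Set
    Fun : ℕ → Set
    Rel : ℕ → Set
    𝟘   : Con
    eq  : Rel 2
    ⟦_⟧ᶜ : Con → R
    ⟦_⟧ᶠ : ∀ {r} → Fun r → Vec R r → R
    ⟦_⟧ʳ : ∀ {r} → Rel r → Pred (Vec R r) 0ℓ
    eq-equality : ∀ x y → ⟦ eq ⟧ʳ (x ∷ y ∷ []) ⇔ x ≡ y

  graph : ∀ {r} → Fun r → Pred (Vec R (suc r)) 0ℓ
  graph f v = ∃ λ xs → v ≡ xs ∷ʳ ⟦ f ⟧ᶠ xs

IsFinite : Set → Set
IsFinite A = ∃ λ n → A ↔ Fin n

FiniteLanguage : {R : Set} → Language R → Set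
FiniteLanguage L = IsFinite Con × IsFinite (∃ Fun) × IsFinite (∃ Rel)
  where open Language L

CountableLanguage : {R : Set} → Language R → Set
CountableLanguage L = (Con ↣ ℕ) × (∃ Fun ↣ ℕ) × (∃ Rel ↣ ℕ)
  where open Language L

module _ {R : Set} (L : Language R) where
  open Language L

  -- Terms and formulas in the variables x₁, …, xₖ; xᵢ is var of i - 1.
  data Term (k : ℕ) : Set where
    var : Fin k → Term k
    con : Con → Term k
    app : ∀ {r} → Fun r → Vec (Term k) r → Term k

  data BasicFormula (k : ℕ) : Set where
    rel : ∀ {r} → Rel r → Vec (Term k) r → BasicFormula k

  System : ℕ → Set
  System k = List (BasicFormula k)

module _ {R : Set} {L : Language R} where
  open Language L

  eval  : ∀ {k} → Vec R k → Term L k → R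
  evals : ∀ {k r} → Vec R k → Vec (Term L k) r → Vec R r
  eval ρ (var i)    = lookup ρ i
  eval ρ (con c)    = ⟦ c ⟧ᶜ
  eval ρ (app f ts) = ⟦ f ⟧ᶠ (evals ρ ts)
  evals ρ []        = []
  evals ρ (t ∷ ts)  = eval ρ t ∷ evals ρ ts

  Holds : ∀ {k} → Vec R k → BasicFormula L k → Set
  Holds ρ (rel S ts) = ⟦ S ⟧ʳ (evals ρ ts)

  Solution : ∀ {k} → System L k → Pred (Vec R k) 0ℓ
  Solution T ρ = All (Holds ρ) T

  data Occurs {k} (i : Fin k) : Term L k → Set where
    here : Occurs i (var i)
    arg  : ∀ {r} {f : Fun r} {ts} → VecAny (Occurs i) ts → Occurs i (app f ts)

  OccursInFormula : ∀ {k} → Fin k → BasicFormula L k → Set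
  OccursInFormula i (rel S ts) = VecAny (Occurs i) ts

  -- The last variable xₖ, if there is one, occurs.  The code of a system does
  -- not record k; this condition makes the number of variables of a system a
  -- function of its code.
  LastVariableOccurs : ∀ {k} → System L k → Set
  LastVariableOccurs {k} T = ∀ (i : Fin k) → suc (toℕ i) ≡ k → Any (OccursInFormula i) T

Diophantine : {R : Set} (L : Language R) → ∀ {k} → Pred (Vec R k) 0ℓ → Set
Diophantine {R} L {k} S = ∃ λ l → Σ (System L (k + l)) λ T →
  S ≐ (λ xs → ∃ λ (ys : Vec R l) → Solution T (xs Vec.++ ys))

image : {A B : Set} (d : A → B) → ∀ {k} → Pred (Vec A k) 0ℓ → Pred (Vec B k) 0ℓ
image d S v = ∃ λ xs → S xs × v ≡ Vec.map d xs

-- These x form S_c′(L).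
DiophantineElement : {R : Set} (L : Language R) → Pred R 0ℓ
DiophantineElement L x = Diophantine L (λ v → v ≡ x ∷ [])

record RecursiveRing : Set₁ where
  field
    Carrier : Set
    add mul : Carrier → Carrier → Carrier
    neg     : Carrier → Carrier
    0# 1#   : Carrier
    isRing  : IsRing _≡_ add mul neg 0# 1#
    j           : Carrier → ℕ
    j-injective : Injective _≡_ _≡_ j
    image-recursive : RecursiveSet {1} (λ v → ∃ λ x → v ≡ j x ∷ [])
    -- As the image is recursive, a function on it is recursive iff it is the
    -- restriction of a total recursive function.
    add-recursive : ∃ λ f → Recursive f × (∀ x y → f (j x ∷ j y ∷ []) ≡ j (add x y))
    mul-recursive : ∃ λ f → Recursive f × (∀ x y → f (j x ∷ j y ∷ []) ≡ j (mul x y))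

-- The language L′ on a subset R₀ of R, given by its inclusion ι, that contains
-- the constants of L: functions are replaced by their graphs.
data RestrictedRel {R : Set} (L : Language R) : ℕ → Set where
  graphOf : ∀ {r} → Language.Fun L r → RestrictedRel L (suc r)
  old     : ∀ {r} → Language.Rel L r → RestrictedRel L r

restrict : {R R₀ : Set} (L : Language R) (ι : R₀ → R) → Injective _≡_ _≡_ ι →
           (∀ c → ∃ λ x → ι x ≡ Language.⟦_⟧ᶜ L c) → Language R₀
restrict {R₀ = R₀} L ι ι-inj S_c⊂R₀ = record
  { Con  = Con
  ; Fun  = λ _ → ⊥
  ; Rel  = RestrictedRel L
  ; 𝟘    = 𝟘
  ; eq   = old eq
  ; ⟦_⟧ᶜ = λ c → proj₁ (S_c⊂R₀ c)
  ; ⟦_⟧ᶠ = λ ()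
  ; ⟦_⟧ʳ = interp
  ; eq-equality = λ x y → record
    { to        = λ p → ι-inj (Equivalence.to (eq-equality (ι x) (ι y)) p)
    ; from      = λ p → Equivalence.from (eq-equality (ι x) (ι y)) (cong ι p)
    ; to-cong   = cong _
    ; from-cong = cong _
    }
  }
  where
  open Language L
  interp : ∀ {r} → RestrictedRel L r → Pred (Vec R₀ r) 0ℓ
  interp (graphOf f) v = graph f (Vec.map ι v)
  interp (old S)     v = ⟦ S ⟧ʳ (Vec.map ι v)

record CompatibleRing {R : Set} (L : Language R) : Set₁ where
  open Language L using (⟦_⟧ᶜ)
  field
    ring : RecursiveRing
  open RecursiveRing ring public
  field
    ι           : Carrier → R
    ι-injective : Injective _≡_ _≡_ ι
    S_c⊂R₀      : ∀ c → ∃ λ x → ι x ≡ ⟦ c ⟧ᶜ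
    R₀⊂S_c′     : ∀ x → DiophantineElement L (ι x)
  L′ : Language Carrier
  L′ = restrict L ι ι-injective S_c⊂R₀
  field
    S_c′[L′]≡R₀ : ∀ x → DiophantineElement L′ x
    relations-recursive : ∀ {r} (S : Language.Rel L′ r) →
      RecursiveSet (image j (Language.⟦_⟧ʳ L′ S))

HilbertTenthExists : {R : Set} → Language R → Set₁
HilbertTenthExists L = CountableLanguage L × CompatibleRing L

record Numbering {R : Set} (L : Language R) : Set where
  open Language L
  field
    num    : (Con ⊎ ∃ Fun) ↣ ℕ
    relNum : ∃ Rel ↣ ℕ

module _ {R : Set} {L : Language R} (ν : Numbering L) where
  open Numbering ν

  -- The codes of the symbols of a term in bracket-free prefix form.  Variables
  -- are numbered from 1, so 3 ^ n is never a power of 2.  No codes are needed for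
  -- elements of a compatible ring: terms contain only constants of L.
  symbols  : ∀ {k} → Term L k → List ℕ
  symbolss : ∀ {k r} → Vec (Term L k) r → List ℕ
  symbols (var i)         = 3 ^ suc (toℕ i) ∷ []
  symbols (con c)         = 2 ^ Injection.to num (inj₁ c) ∷ []
  symbols (app {r} f ts)  = 2 ^ Injection.to num (inj₂ (r , f)) ∷ symbolss ts
  symbolss []             = []
  symbolss (t ∷ ts)       = symbols t ++ symbolss ts

  J : ∀ {k} → Term L k → ℕ
  J t = primePowers 0 (symbols t)

  formulaCode : ∀ {k} → BasicFormula L k → List ℕ
  formulaCode (rel {r} S ts) = Injection.to relNum (r , S) ∷ map J (toList ts)

  systemCode : ∀ {k} → System L k → List ℕ
  systemCode T = length T ∷ concatMap formulaCode T

DiophantineMap : {R₁ R₂ : Set} → Language R₁ → Language R₂ → (R₁ → R₂) → Set₁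
DiophantineMap {R₁} L₁ L₂ d =
  ∀ k (S : Pred (Vec R₁ k) 0ℓ) → Diophantine L₁ S → Diophantine L₂ (image d S)

Effective : {R₁ R₂ : Set} {L₁ : Language R₁} {L₂ : Language R₂} →
            Numbering L₁ → Numbering L₂ → (R₁ → R₂) → Set
Effective {R₁} {R₂} {L₁} {L₂} ν₁ ν₂ d =
  ∃ λ (D : List ℕ → List ℕ) → RecursiveOnLists D ×
  (∀ {k} (T : System L₁ k) → LastVariableOccurs T →
    ∃ λ l → Σ (System L₂ (k + l)) λ DT →
      D (systemCode ν₁ T) ≡ systemCode ν₂ DT ×
      (∀ (x : Vec R₁ k) → Solution T x →
        ∃ λ (y : Vec R₂ l) → Solution DT (Vec.map d x Vec.++ y)) ×
      (∀ (z : Vec R₂ k) (y : Vec R₂ l) → Solution DT (z Vec.++ y) →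
        ∃ λ (x : Vec R₁ k) → Solution T x × z ≡ Vec.map d x))

module Submission where

-- A term in bracket-free prefix form, read from right to left, is a program for
-- a stack machine: a constant or a variable pushes its value, and an r-ary
-- function replaces the top r entries of the stack by its value at them.  An
-- r-ary relation in front of its terms can be read in the same way, as an
-- operation that tests the top r entries and leaves an arbitrary entry in their
-- place.  So a whole system over L₁ is one program, without any brackets, and x
-- solves the system iff all tests succeed when the program runs on the input x.
--
-- The translated system describes this run inside R₂.  The symbol at position p
-- turns the stack at time p + 1 into the stack at time p, and for the entry at
-- time p and height i there is a variable, cell p i, that stands for its image
-- under d.  The description known for the symbol relates cell p 0 to the entries
-- at time p + 1 and heights 0, …, r - 1, and equations copy the rest of the stack.
-- If A bounds all arities, then it is enough to copy the entries up to height
-- A * p, since the entry at height i + 1 ≤ A * p comes from height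
-- r + i ≤ A * (p + 1) at time p + 1.  The program is preceded by symbols that push
-- all input variables; together with the description of d(R₁) they force every
-- input variable, even one that does not occur in the system, to have a value in
-- d(R₁).
--
-- If the translated system holds, then induction on terms shows that the right
-- cells carry the values of the terms (term-sound); here the injectivity of d
-- identifies the arguments provided by a description with the values of the
-- terms.  Conversely a solution x yields the run over R₁, whose image under d
-- satisfies the translated system (translation⁺).  Applied to a system that
-- defines S, this proves that d(S) is Diophantine (diophantineMap).
--
-- The translation is recursive because no parsing is needed.  Bounded search
-- makes the exponents of the primes in a number recursive, hence also the decoding
-- of Gödel numbers (decodeᴸ), and from this follow the usual constructions of
-- lists, including primitive recursion with lists as values (recursionᴸ).  The
-- code of a system is turned into a program by a left fold that tells relation
-- numbers from term codes by counting down the arity (scan-system).  The program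
-- is then processed position by position, with finitely many cases for the symbol
-- (step-findˢ).  The number k of variables of a system is not needed exactly: the
-- last variable occurs, so k is bounded by the sum of the numbers that represent
-- the symbols of the program, and further input variables do no harm.  The number of auxiliary variables is
-- not part of the code and need not be computed at all.

open import Defs
open import Algebra.Properties.CommutativeSemigroup using (x∙yz≈y∙xz)
open import Data.Fin using (Fin; zero; suc; toℕ; fromℕ; _↑ˡ_)
open import Data.Fin.Properties using (toℕ-fromℕ; toℕ-fromℕ<; toℕ-injective; toℕ<n; toℕ-↑ˡ)
open import Data.List as List
  using (List; []; _∷_; _++_; length; map; concat; concatMap; applyUpTo; upTo; drop; foldl)
open import Data.List.Membership.Propositional using (_∈_)
open import Data.List.Membership.Propositional.Properties
  using (∈-tabulate⁺; ∈-map⁺; ∈-++⁺ˡ; ∈-++⁺ʳ; ∈-upTo⁺)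
open import Data.List.Properties
  using (applyUpTo-∷ʳ; length-applyUpTo; map-applyUpTo; map-++; map-∘; concat-++; concatMap-++;
         length-++; length-map; ++-identityʳ; ++-assoc)
open import Data.List.Relation.Unary.All as All using (All; []; _∷_)
import Data.List.Relation.Unary.All.Properties as AllP
open import Data.List.Relation.Unary.Any using (Any; here; there)
open import Data.Nat
open import Data.Nat.DivMod using (_mod_; m<n⇒m%n≡m; m%n<n)
open import Data.Nat.Divisibility
open import Data.Nat.ListAction using (sum)
open import Data.Nat.ListAction.Properties using (sum-++)
open import Data.Nat.Primality
open import Data.Nat.Properties
open import Data.Nat.Solver using (module +-*-Solver)
open import Data.Product using (∃; Σ; _×_; _,_; proj₁; proj₂)
open import Data.Sum using (_⊎_; inj₁; inj₂)
open import Data.Unit using (⊤; tt)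
open import Data.Vec as Vec using (Vec; []; _∷_; _∷ʳ_; head; tail; lookup; tabulate)
open import Data.Vec.Properties as VecP
  using (tabulate-∘; tabulate∘lookup; tabulate-cong; lookup∘tabulate; lookup-map; lookup-++ˡ;
         map-∷ʳ; ∷-injective; ∷ʳ-injective)
open import Data.Vec.Relation.Unary.All using ([]; _∷_) renaming (All to VecAll)
open import Data.Vec.Relation.Unary.All.Properties using (lookup⁺; tabulate⁺; ++⁺)
open import Data.Vec.Relation.Unary.Any as VecAny using () renaming (Any to VecAny)
open import Function using (_∘_; id)
open import Function.Bundles using (Injection; Inverse; Equivalence; _↔_)
open import Function.Definitions using (Injective)
open import Level using (0ℓ)
open import Relation.Binary using (tri<; tri≈; tri>)
open import Relation.Binary.PropositionalEquality hiding (J)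
open import Relation.Nullary using (¬_; contradiction)
open import Relation.Unary using (Pred)

private variable
  n m : ℕ

-- Recursive functions: arithmetic and bounded search

-- The functions substituted into g form a vector, which is applied pointwise.
compositionʳ : ∀ {g : Vec ℕ m → ℕ} {fs : Vec (Vec ℕ n → ℕ) m} → Recursive g →
  VecAll Recursive fs → Recursive (λ v → g (Vec.map (λ f → f v) fs))
compositionʳ {g = g} {fs} rg rfs =
  ext (λ v → cong g (trans (tabulate-∘ (λ f → f v) (lookup fs))
                           (cong (Vec.map _) (tabulate∘lookup fs))))
      (compʳ rg (λ i → lookup⁺ rfs i))

headʳ : Recursive {suc n} head
headʳ = ext (λ { (x ∷ v) → refl }) (projʳ zero)

weakenʳ : ∀ {f : Vec ℕ n → ℕ} → Recursive f → Recursive (λ v → f (tail v))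
weakenʳ {f = f} rf = ext (λ { (x ∷ v) → cong f (tabulate∘lookup v) })
                         (compʳ rf (λ i → projʳ (suc i)))

-- A value for the first argument of f, computed from the other arguments.
substituteʳ : ∀ {f : Vec ℕ (suc n) → ℕ} {a : Vec ℕ n → ℕ} → Recursive f → Recursive a →
  Recursive (λ v → f (a v ∷ v))
substituteʳ {f = f} {a} rf ra =
  ext (λ v → cong (λ w → f (a v ∷ w)) (tabulate∘lookup v))
      (compʳ {h = λ { zero → a ; (suc i) v → lookup v i }} rf
             (λ { zero → ra ; (suc i) → projʳ i }))

-- Primitive recursion in the form used below: F is a function of the recursion
-- variable and further arguments that satisfies the recursion equations.  In
-- the recursiveness of the step, the first two arguments are the recursion
-- variable and the previous value.
recursionʳ : (F : ℕ → Vec ℕ n → ℕ) (step : ℕ → ℕ → Vec ℕ n → ℕ) {base N : Vec ℕ n → ℕ} →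
  (∀ v → F 0 v ≡ base v) → (∀ i v → F (suc i) v ≡ step i (F i v) v) →
  Recursive base → Recursive (λ w → step (head w) (head (tail w)) (tail (tail w))) →
  Recursive N → Recursive (λ v → F (N v) v)
recursionʳ F step {base} {N} F0 Fs rb rs rN =
  ext (λ v → primRec≡ (N v) v) (substituteʳ (precʳ rb rs) rN)
  where
  primRec≡ : ∀ i v → primRec base (λ w → step (head w) (head (tail w)) (tail (tail w))) i v ≡ F i v
  primRec≡ zero    v = sym (F0 v)
  primRec≡ (suc i) v = trans (cong (λ r → step i r v) (primRec≡ i v)) (sym (Fs i v))

constantʳ : ∀ c → Recursive {n} (λ _ → c)
constantʳ zero    = zeroʳ
constantʳ (suc c) = compositionʳ sucʳ (constantʳ c ∷ [])

successorʳ : ∀ {f : Vec ℕ n → ℕ} → Recursive f → Recursive (λ v → suc (f v))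
successorʳ rf = compositionʳ sucʳ (rf ∷ [])

+ʳ : ∀ {f g : Vec ℕ n → ℕ} → Recursive f → Recursive g → Recursive (λ v → f v + g v)
+ʳ {g = g} rf rg = recursionʳ (λ i v → i + g v) (λ _ r _ → suc r) (λ _ → refl) (λ _ _ → refl)
  rg (successorʳ (weakenʳ headʳ)) rf

predʳ : ∀ {f : Vec ℕ n → ℕ} → Recursive f → Recursive (λ v → pred (f v))
predʳ rf = recursionʳ (λ i _ → pred i) (λ i _ _ → i) (λ _ → refl) (λ _ _ → refl) zeroʳ headʳ rf

monusʳ : ∀ {f g : Vec ℕ n → ℕ} → Recursive f → Recursive g → Recursive (λ v → f v ∸ g v)
monusʳ {f = f} rf rg = recursionʳ (λ i v → f v ∸ i) (λ _ r _ → pred r) (λ _ → refl)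
  (λ i v → sym (pred[m∸n]≡m∸[1+n] (f v) i)) rf (predʳ (weakenʳ headʳ)) rg

*ʳ : ∀ {f g : Vec ℕ n → ℕ} → Recursive f → Recursive g → Recursive (λ v → f v * g v)
*ʳ {g = g} rf rg = recursionʳ (λ i v → i * g v) (λ _ r v → g v + r) (λ _ → refl) (λ _ _ → refl)
  zeroʳ (+ʳ (weakenʳ (weakenʳ rg)) (weakenʳ headʳ)) rf

^ʳ : ∀ {f g : Vec ℕ n → ℕ} → Recursive f → Recursive g → Recursive (λ v → f v ^ g v)
^ʳ {f = f} rf rg = recursionʳ (λ i v → f v ^ i) (λ _ r v → f v * r) (λ _ → refl) (λ _ _ → refl)
  (constantʳ 1) (*ʳ (weakenʳ (weakenʳ rf)) (weakenʳ headʳ)) rg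

-- Tests are numbers: 0 stands for true, everything else for false.
cond : {A : Set} → ℕ → A → A → A
cond zero    a b = a
cond (suc _) a b = b

condʳ : ∀ {c a b : Vec ℕ n → ℕ} → Recursive c → Recursive a → Recursive b →
  Recursive (λ v → cond (c v) (a v) (b v))
condʳ {a = a} {b} rc ra rb = recursionʳ (λ i v → cond i (a v) (b v)) (λ _ _ → b)
  (λ _ → refl) (λ _ _ → refl) ra (weakenʳ (weakenʳ rb)) rc

cond-map : ∀ {A B : Set} (h : A → B) c {a b : A} → cond c (h a) (h b) ≡ h (cond c a b)
cond-map h zero    = refl
cond-map h (suc c) = refl

-- The test for equality.
unequal : ℕ → ℕ → ℕ
unequal a b = (a ∸ b) + (b ∸ a)

unequal≡0⇒≡ : ∀ a b → unequal a b ≡ 0 → a ≡ b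
unequal≡0⇒≡ a b eq = ≤-antisym (m∸n≡0⇒m≤n (m+n≡0⇒m≡0 (a ∸ b) eq)) (m∸n≡0⇒m≤n (m+n≡0⇒n≡0 (a ∸ b) eq))

unequal-refl : ∀ a → unequal a a ≡ 0
unequal-refl a = cong₂ _+_ (n∸n≡0 a) (n∸n≡0 a)

unequalʳ : ∀ {a b : Vec ℕ n → ℕ} → Recursive a → Recursive b → Recursive (λ v → unequal (a v) (b v))
unequalʳ ra rb = +ʳ (monusʳ ra rb) (monusʳ rb ra)

-- The least i < b that passes the test g, or b if there is none.
μ : (ℕ → ℕ) → ℕ → ℕ
μ g zero    = 0
μ g (suc b) = cond (g (μ g b)) (μ g b) (suc b)

μʳ : ∀ {g : ℕ → Vec ℕ n → ℕ} {b : Vec ℕ n → ℕ} →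
  Recursive (λ w → g (head w) (tail w)) → Recursive b → Recursive (λ v → μ (λ i → g i v) (b v))
μʳ {g = g} rg rb = recursionʳ (λ i v → μ (λ i → g i v) i) (λ i r v → cond (g r v) r (suc i))
  (λ _ → refl) (λ _ _ → refl) zeroʳ (condʳ (weakenʳ rg) (weakenʳ headʳ) (successorʳ headʳ)) rb

cond-elim : {A : Set} (P : A → Set) (c : ℕ) {a b : A} →
  (c ≡ 0 → P a) → (c ≢ 0 → P b) → P (cond c a b)
cond-elim P zero    pa pb = pa refl
cond-elim P (suc c) pa pb = pb λ ()

μ≤ : ∀ (g : ℕ → ℕ) b → μ g b ≤ b
μ≤ g zero    = z≤n
μ≤ g (suc b) = cond-elim (_≤ suc b) (g (μ g b)) (λ _ → m≤n⇒m≤1+n (μ≤ g b)) (λ _ → ≤-refl)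

μ-true : ∀ (g : ℕ → ℕ) b m → m ≤ b → g m ≡ 0 → g (μ g b) ≡ 0
μ-true g zero    .0 z≤n gm = gm
μ-true g (suc b) m  m≤b gm = cond-elim (λ i → g i ≡ 0) (g (μ g b)) id
  (λ ≢0 → case m≤b ≢0)
  where
  case : m ≤ suc b → g (μ g b) ≢ 0 → g (suc b) ≡ 0
  case m≤b ≢0 with m≤n⇒m<n∨m≡n m≤b
  ... | inj₁ m<b  = contradiction (μ-true g b m (s≤s⁻¹ m<b) gm) ≢0
  ... | inj₂ refl = gm

μ-minimal : ∀ (g : ℕ → ℕ) b i → i < μ g b → g i ≢ 0
μ-minimal g (suc b) i = cond-elim (λ k → i < k → g i ≢ 0) (g (μ g b)) (λ _ → μ-minimal g b i)
  λ ≢0 i≤b gi → ≢0 (μ-true g b i (s≤s⁻¹ i≤b) gi)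

μ-unique : ∀ (g : ℕ → ℕ) b m → m ≤ b → g m ≡ 0 → (∀ i → i < m → g i ≢ 0) → μ g b ≡ m
μ-unique g b m m≤b gm least = ≤-antisym
  (≮⇒≥ (λ m<μ → μ-minimal g b m m<μ gm))
  (≮⇒≥ (λ μ<m → least _ μ<m (μ-true g b m m≤b gm)))

-- Passes iff some i ≤ b passes g.
exists : (ℕ → ℕ) → ℕ → ℕ
exists g b = g (μ g b)

existsʳ : ∀ {g : ℕ → Vec ℕ n → ℕ} {b : Vec ℕ n → ℕ} →
  Recursive (λ w → g (head w) (tail w)) → Recursive b → Recursive (λ v → exists (λ i → g i v) (b v))
existsʳ rg rb = substituteʳ rg (μʳ rg rb)

-- Negation of a test.
not : ℕ → ℕ
not c = 1 ∸ c

not⁻ : ∀ {c} → not c ≡ 0 → c ≢ 0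
not⁻ {suc c} _ ()

not⁺ : ∀ {c} → c ≢ 0 → not c ≡ 0
not⁺ {zero}  c≢0 = contradiction refl c≢0
not⁺ {suc c} _   = 0∸n≡0 c

-- Divisibility, prime numbers and exponents

-- Passes iff a divides c.  If it does, then some quotient is at most c, also for
-- a = 0.
nondivisor : ℕ → ℕ → ℕ
nondivisor a c = exists (λ q → unequal c (q * a)) c

nondivisor≡0⇒∣ : ∀ a c → nondivisor a c ≡ 0 → a ∣ c
nondivisor≡0⇒∣ a c eq = divides (μ (λ q → unequal c (q * a)) c) (unequal≡0⇒≡ c _ eq)

∣⇒nondivisor≡0 : ∀ a c → a ∣ c → nondivisor a c ≡ 0
∣⇒nondivisor≡0 zero    c (divides q eq) = μ-true (λ q → unequal c (q * 0)) c 0 z≤n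
  (trans (cong (unequal c) (sym (trans eq (*-zeroʳ q)))) (unequal-refl c))
∣⇒nondivisor≡0 (suc a) c (divides q eq) = μ-true (λ q → unequal c (q * suc a)) c q
  (subst (q ≤_) (sym eq) (m≤m*n q (suc a))) (trans (cong (unequal c) (sym eq)) (unequal-refl c))

nondivisorʳ : ∀ {a b : Vec ℕ n → ℕ} → Recursive a → Recursive b →
  Recursive (λ v → nondivisor (a v) (b v))
nondivisorʳ {a = a} {b} ra rb = existsʳ {g = λ q v → unequal (b v) (q * a v)}
  (unequalʳ (weakenʳ rb) (*ʳ headʳ (weakenʳ ra))) rb

-- Passes iff 2 + e is a divisor of p less than p.
properDivisor : ℕ → ℕ → ℕ
properDivisor p e = nondivisor (2 + e) p + (3 + e ∸ p)

-- Passes iff p is prime.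
nonprime : ℕ → ℕ
nonprime p = (2 ∸ p) + not (exists (properDivisor p) p)

prime⇒nonprime≡0 : ∀ {p} → Prime p → nonprime p ≡ 0
prime⇒nonprime≡0 {p} pr@(prime notComposite) = cong₂ _+_ (m≤n⇒m∸n≡0 (nonTrivial⇒n>1 p))
  (not⁺ λ eq → let e = μ (properDivisor p) p in
    notComposite (hasNonTrivialDivisor {divisor = 2 + e}
      (m∸n≡0⇒m≤n (m+n≡0⇒n≡0 (nondivisor (2 + e) p) eq))
      (nondivisor≡0⇒∣ (2 + e) p (m+n≡0⇒m≡0 _ eq))))

nonprime≡0⇒prime : ∀ {p} → nonprime p ≡ 0 → Prime p
nonprime≡0⇒prime {p} eq = prime {{n>1⇒nonTrivial (m∸n≡0⇒m≤n (m+n≡0⇒m≡0 (2 ∸ p) eq))}} notComposite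
  where
  notComposite : ¬ Composite p
  notComposite (hasNonTrivialDivisor {suc (suc e)} d<p d∣p) =
    not⁻ (m+n≡0⇒n≡0 (2 ∸ p) eq)
      (μ-true (properDivisor p) p e (≤-trans (m≤n+m e 3) d<p)
        (cong₂ _+_ (∣⇒nondivisor≡0 (2 + e) p d∣p) (m≤n⇒m∸n≡0 d<p)))

nonprimeʳ : ∀ {p : Vec ℕ n → ℕ} → Recursive p → Recursive (λ v → nonprime (p v))
nonprimeʳ {p = p} rp = +ʳ (monusʳ (constantʳ 2) rp) (monusʳ (constantʳ 1)
  (existsʳ {g = λ e v → properDivisor (p v) e}
    (+ʳ (nondivisorʳ (successorʳ (successorʳ headʳ)) (weakenʳ rp))
        (monusʳ (successorʳ (successorʳ (successorʳ headʳ))) (weakenʳ rp))) rp))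

-- Unbounded search, as the existence of a greater prime is known.
nextPrimeʳ : ∀ {f : Vec ℕ n → ℕ} → Recursive f → Recursive (λ v → proj₁ (nextPrime (f v)))
nextPrimeʳ {f = f} rf = minʳ {g = λ w → (suc (f (tail w)) ∸ head w) + nonprime (head w)}
  (+ʳ (monusʳ (successorʳ (weakenʳ rf)) headʳ) (nonprimeʳ headʳ))
  (λ v → let _ , n<p , pr , _ = nextPrime (f v) in cong₂ _+_ (m≤n⇒m∸n≡0 n<p) (prime⇒nonprime≡0 pr))
  (λ v m m<p eq → let _ , _ , _ , least = nextPrime (f v) in
    <⇒≱ m<p (least m (m∸n≡0⇒m≤n (m+n≡0⇒m≡0 _ eq))
                     (nonprime≡0⇒prime (m+n≡0⇒n≡0 (suc (f v) ∸ m) eq))))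

nthPrimeʳ : ∀ {f : Vec ℕ n → ℕ} → Recursive f → Recursive (λ v → nthPrime (f v))
nthPrimeʳ rf = recursionʳ (λ i _ → nthPrime i) (λ _ r _ → proj₁ (nextPrime r))
  (λ _ → refl) (λ _ _ → refl) (nextPrimeʳ zeroʳ) (nextPrimeʳ (weakenʳ headʳ)) rf

nthPrime-prime : ∀ i → Prime (nthPrime i)
nthPrime-prime zero    = let _ , _ , pr , _ = nextPrime 0 in pr
nthPrime-prime (suc i) = let _ , _ , pr , _ = nextPrime (nthPrime i) in pr

nthPrime-< : ∀ {i j} → i < j → nthPrime i < nthPrime j
nthPrime-< {i} {suc j} i<j with m≤n⇒m<n∨m≡n (s≤s⁻¹ i<j)
... | inj₁ i<j′ = <-trans (nthPrime-< i<j′) (proj₁ (proj₂ (nextPrime (nthPrime j))))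
... | inj₂ refl = proj₁ (proj₂ (nextPrime (nthPrime j)))

1<nthPrime : ∀ i → 1 < nthPrime i
1<nthPrime i = nonTrivial⇒n>1 _ {{prime⇒nonTrivial (nthPrime-prime i)}}

∣^⇒∣ : ∀ {p} → Prime p → ∀ a s → p ∣ a ^ s → p ∣ a
∣^⇒∣ pr a zero    p∣1 = contradiction (subst Prime (∣1⇒≡1 p∣1) pr) ¬prime[1]
∣^⇒∣ pr a (suc s) p∣a^s with euclidsLemma a (a ^ s) pr p∣a^s
... | inj₁ p∣a  = p∣a
... | inj₂ p∣a^ = ∣^⇒∣ pr a s p∣a^

nthPrime-∤ : ∀ {i j} s → i ≢ j → ¬ nthPrime i ∣ nthPrime j ^ s
nthPrime-∤ {i} {j} s i≢j p∣
  with prime⇒irreducible (nthPrime-prime j) (∣^⇒∣ (nthPrime-prime i) _ s p∣) | <-cmp i j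
... | inj₁ ≡1 | _ = contradiction (subst Prime ≡1 (nthPrime-prime i)) ¬prime[1]
... | inj₂ eq | tri< i<j _ _ = <⇒≢ (nthPrime-< i<j) eq
... | inj₂ eq | tri≈ _ i≡j _ = i≢j i≡j
... | inj₂ eq | tri> _ _ j<i = <⇒≢ (nthPrime-< j<i) (sym eq)

-- The i-th element, counted from 0, and 0 beyond the end of the list.
nth : List ℕ → ℕ → ℕ
nth []       i       = 0
nth (x ∷ xs) zero    = x
nth (x ∷ xs) (suc i) = nth xs i

primePowers-coprime : ∀ m ss i → i < m → ¬ nthPrime i ∣ primePowers m ss
primePowers-coprime m []       i i<m p∣ = nthPrime-∤ {i} {suc i} 0 (<⇒≢ ≤-refl) p∣
primePowers-coprime m (s ∷ ss) i i<m p∣ with euclidsLemma _ _ (nthPrime-prime i) p∣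
... | inj₁ p∣p = nthPrime-∤ {i} {m} s (<⇒≢ i<m) p∣p
... | inj₂ p∣r = primePowers-coprime (suc m) ss i (m<n⇒m<1+n i<m) p∣r

-- The factor r collects the powers of the other primes.
primePowers-factor : ∀ m ss i →
  ∃ λ r → primePowers m ss ≡ nthPrime (m + i) ^ nth ss i * r × ¬ nthPrime (m + i) ∣ r
primePowers-factor m []       i = 1 , refl , primePowers-coprime (suc (m + i)) [] (m + i) ≤-refl
primePowers-factor m (s ∷ ss) zero rewrite +-identityʳ m =
  primePowers (suc m) ss , refl , primePowers-coprime (suc m) ss m ≤-refl
primePowers-factor m (s ∷ ss) (suc i) with primePowers-factor (suc m) ss i
... | r , eq , p∤r rewrite +-suc m i = nthPrime m ^ s * r ,
  trans (cong (nthPrime m ^ s *_) eq)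
    (x∙yz≈y∙xz *-commutativeSemigroup (nthPrime m ^ s) (nthPrime (suc (m + i)) ^ nth ss i) r) ,
  λ p∣ → case (euclidsLemma _ _ (nthPrime-prime (suc (m + i))) p∣)
  where
  case : nthPrime (suc (m + i)) ∣ nthPrime m ^ s ⊎ nthPrime (suc (m + i)) ∣ r → _
  case (inj₁ p∣p) = nthPrime-∤ {suc (m + i)} {m} s (<⇒≢ (s≤s (m≤m+n m i)) ∘ sym) p∣p
  case (inj₂ p∣r) = p∤r p∣r

n<m^n : ∀ {m} → 1 < m → ∀ n → n < m ^ n
n<m^n 1<m zero    = s≤s z≤n
n<m^n {m} 1<m (suc n) = ≤-<-trans (n<m^n 1<m n) (^-monoʳ-< m 1<m {n} {suc n} ≤-refl)

-- The exponent of the i-th prime in c, for c > 0: the least e such that the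
-- (e + 1)-st power of this prime does not divide c.  The exponent is less than c,
-- so the search may stop at c.
exponent : ℕ → ℕ → ℕ
exponent c i = μ (λ e → not (nondivisor (nthPrime i ^ suc e) c)) c

exponentʳ : ∀ {c i : Vec ℕ n → ℕ} → Recursive c → Recursive i →
  Recursive (λ v → exponent (c v) (i v))
exponentʳ {c = c} {i} rc ri = μʳ {g = λ e v → not (nondivisor (nthPrime (i v) ^ suc e) (c v))}
  (monusʳ (constantʳ 1)
    (nondivisorʳ (^ʳ (weakenʳ (nthPrimeʳ ri)) (successorʳ headʳ)) (weakenʳ rc))) rc

primePowers≢0 : ∀ m ss → NonZero (primePowers m ss)
primePowers≢0 m []       = _
primePowers≢0 m (s ∷ ss) =
  m*n≢0 _ _ {{m^n≢0 _ s {{prime⇒nonZero (nthPrime-prime m)}}}} {{primePowers≢0 (suc m) ss}}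

exponent-primePowers : ∀ ss i → exponent (primePowers 0 ss) i ≡ nth ss i
exponent-primePowers ss i with primePowers-factor 0 ss i
... | r , eq , p∤r = μ-unique _ _ s s≤c
  (not⁺ λ nd → p∤r (*-cancelˡ-∣ (p ^ s) {{p^≢0 s}}
    (subst₂ _∣_ (*-comm p (p ^ s)) eq (nondivisor≡0⇒∣ _ _ nd))))
  λ j j<s n≡0 → not⁻ n≡0 (∣⇒nondivisor≡0 _ _ (subst (p ^ suc j ∣_) (sym eq)
     (∣-trans (≤⇒^∣^ j<s) (m∣m*n r))))
  where
  c = primePowers 0 ss
  p = nthPrime i
  s = nth ss i
  p^≢0 : ∀ k → NonZero (p ^ k)
  p^≢0 k = m^n≢0 p k {{prime⇒nonZero (nthPrime-prime i)}}
  ≤⇒^∣^ : ∀ {j k} → j ≤ k → p ^ j ∣ p ^ k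
  ≤⇒^∣^ {j} {k} j≤k = subst (λ k → p ^ j ∣ p ^ k) (m+[n∸m]≡n j≤k)
     (subst (p ^ j ∣_) (sym (^-distribˡ-+-* p j (k ∸ j))) (m∣m*n _))
  s≤c : s ≤ c
  s≤c = ≤-trans (<⇒≤ (n<m^n (1<nthPrime i) s))
    (∣⇒≤ {{primePowers≢0 0 ss}} (divides r (trans eq (*-comm _ r))))

-- Lists with recursive codes

primePowers-∷ʳ : ∀ m ss s →
  primePowers m (ss ++ s ∷ []) ≡ primePowers m ss * nthPrime (m + length ss) ^ s
primePowers-∷ʳ m []       s rewrite +-identityʳ m = *-comm (nthPrime m ^ s) 1
primePowers-∷ʳ m (t ∷ ss) s rewrite +-suc m (length ss) =
  trans (cong (nthPrime m ^ t *_) (primePowers-∷ʳ (suc m) ss s)) (sym (*-assoc (nthPrime m ^ t) _ _))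

seqCode-applyUpTo-suc : ∀ f n →
  seqCode (applyUpTo f (suc n)) ≡ seqCode (applyUpTo f n) * nthPrime n ^ suc (f n)
seqCode-applyUpTo-suc f n =
  trans (cong seqCode (sym (applyUpTo-∷ʳ f n)))
  (trans (cong (primePowers 0) (map-++ suc (applyUpTo f n) (f n ∷ [])))
  (trans (primePowers-∷ʳ 0 (map suc (applyUpTo f n)) (suc (f n)))
         (cong (λ k → seqCode (applyUpTo f n) * nthPrime k ^ suc (f n))
               (trans (length-map suc (applyUpTo f n)) (length-applyUpTo f n)))))

applyUpTo-cong : {A : Set} {f g : ℕ → A} → (∀ i → f i ≡ g i) → ∀ n → applyUpTo f n ≡ applyUpTo g n
applyUpTo-cong eq zero    = refl
applyUpTo-cong eq (suc n) = cong₂ _∷_ (eq 0) (applyUpTo-cong (λ i → eq (suc i)) n)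

applyUpTo-nth : ∀ as → applyUpTo (nth as) (length as) ≡ as
applyUpTo-nth []       = refl
applyUpTo-nth (a ∷ as) = cong (a ∷_) (applyUpTo-nth as)

nth-map-suc : ∀ as i → pred (nth (map suc as) i) ≡ nth as i
nth-map-suc []       i       = refl
nth-map-suc (a ∷ as) zero    = refl
nth-map-suc (a ∷ as) (suc i) = nth-map-suc as i

-- The length of the list with code c: the position of the first prime that does
-- not divide c, since the exponents in the code of a list are positive.
codedLength : ℕ → ℕ
codedLength c = μ (exponent c) c

nth-≥ : ∀ as i → length as ≤ i → nth as i ≡ 0
nth-≥ []       i       _ = refl
nth-≥ (a ∷ as) (suc i) h = nth-≥ as i (s≤s⁻¹ h)

nth-map-suc≢0 : ∀ as i → i < length as → nth (map suc as) i ≢ 0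
nth-map-suc≢0 (a ∷ as) (suc i) h = nth-map-suc≢0 as i (s≤s⁻¹ h)

length≤primePowers : ∀ m as → length as < primePowers m (map suc as)
length≤primePowers m []       = s≤s z≤n
length≤primePowers m (a ∷ as) = begin
  2 + length as ≤⟨ m<m*n (suc (length as)) 2 (s≤s (s≤s z≤n)) ⟩
  suc (length as) * 2 ≡⟨ *-comm (suc (length as)) 2 ⟩
  2 * suc (length as) ≤⟨ *-mono-≤ (≤-trans (s≤s (s≤s z≤n)) (n<m^n (1<nthPrime m) (suc a)))
                                  (length≤primePowers (suc m) as) ⟩
  nthPrime m ^ suc a * primePowers (suc m) (map suc as) ∎
  where open ≤-Reasoning

codedLength-seqCode : ∀ as → codedLength (seqCode as) ≡ length as
codedLength-seqCode as = μ-unique _ _ (length as) (<⇒≤ (length≤primePowers 0 as))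
  (trans (exponent-primePowers (map suc as) (length as))
         (nth-≥ (map suc as) (length as) (≤-reflexive (length-map suc as))))
  (λ i i<len eq → nth-map-suc≢0 as i i<len (trans (sym (exponent-primePowers (map suc as) i)) eq))

-- Decoding of sequence numbers, with arbitrary values at numbers that do not
-- code a sequence.
decode : ℕ → List ℕ
decode c = applyUpTo (λ i → pred (exponent c i)) (codedLength c)

exponent-seqCode : ∀ as i → pred (exponent (seqCode as) i) ≡ nth as i
exponent-seqCode as i = trans (cong pred (exponent-primePowers (map suc as) i)) (nth-map-suc as i)

decode-seqCode : ∀ as → decode (seqCode as) ≡ as
decode-seqCode as = trans (applyUpTo-cong (exponent-seqCode as) _)
  (trans (cong (applyUpTo (nth as)) (codedLength-seqCode as)) (applyUpTo-nth as))

-- Recursive functions with lists as values, by way of Gödel numbers.  The record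
-- allows F to be inferred, and keeps codes from being unfolded.
record Recursiveᴸ {n} (F : Vec ℕ n → List ℕ) : Set where
  constructor listʳ
  field codeʳ : Recursive (λ v → seqCode (F v))
open Recursiveᴸ

extᴸ : ∀ {F G : Vec ℕ n → List ℕ} → (∀ v → F v ≡ G v) → Recursiveᴸ F → Recursiveᴸ G
extᴸ eq rF = listʳ (ext (λ v → cong seqCode (eq v)) (codeʳ rF))

weakenᴸ : ∀ {F : Vec ℕ n → List ℕ} → Recursiveᴸ F → Recursiveᴸ (λ v → F (tail v))
weakenᴸ rF = listʳ (weakenʳ (codeʳ rF))

nilᴸ : Recursiveᴸ {n} (λ _ → [])
nilᴸ = listʳ (constantʳ 1)

-- A function of the recursion variable, used in a step that also receives the
-- previous value.
skipʳ : ∀ (f : ℕ → Vec ℕ n → ℕ) → Recursive (λ w → f (head w) (tail w)) →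
  Recursive (λ w → f (head w) (tail (tail w)))
skipʳ f rf = ext (λ { (i ∷ r ∷ v) → cong (f i) (tabulate∘lookup v) })
  (compʳ {h = λ { zero → head ; (suc i) v → lookup v (suc (suc i)) }} rf
         (λ { zero → headʳ ; (suc i) → projʳ (suc (suc i)) }))

-- The code of an initial segment of f is a product of prime powers; all
-- further constructions of lists are reduced to this one.
applyUpToᴸ : ∀ (f : ℕ → Vec ℕ n → ℕ) {N : Vec ℕ n → ℕ} → Recursive (λ w → f (head w) (tail w)) →
  Recursive N → Recursiveᴸ (λ v → applyUpTo (λ i → f i v) (N v))
applyUpToᴸ f rf rN = listʳ (recursionʳ (λ i v → seqCode (applyUpTo (λ i → f i v) i))
  (λ i r v → r * nthPrime i ^ suc (f i v)) (λ _ → refl)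
  (λ i v → seqCode-applyUpTo-suc (λ i → f i v) i) (constantʳ 1)
  (*ʳ (weakenʳ headʳ) (^ʳ (nthPrimeʳ headʳ)
    (successorʳ (skipʳ f rf))))
  rN)

lengthʳ : ∀ {F : Vec ℕ n → List ℕ} → Recursiveᴸ F → Recursive (λ v → length (F v))
lengthʳ {F = F} rF = ext (λ v → codedLength-seqCode (F v))
  (μʳ {g = λ i v → exponent (seqCode (F v)) i} (exponentʳ (weakenʳ (codeʳ rF)) headʳ) (codeʳ rF))

nthʳ : ∀ {F : Vec ℕ n → List ℕ} {i : Vec ℕ n → ℕ} → Recursiveᴸ F → Recursive i →
  Recursive (λ v → nth (F v) (i v))
nthʳ {F = F} {i} rF ri = ext (λ v → exponent-seqCode (F v) (i v)) (predʳ (exponentʳ (codeʳ rF) ri))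

decodeᴸ : ∀ {c : Vec ℕ n → ℕ} → Recursive c → Recursiveᴸ (λ v → decode (c v))
decodeᴸ {c = c} rc = applyUpToᴸ (λ i v → pred (exponent (c v) i)) (predʳ (exponentʳ (weakenʳ rc) headʳ))
  (μʳ {g = λ i v → exponent (c v) i} (exponentʳ (weakenʳ rc) headʳ) rc)

singletonᴸ : ∀ {f : Vec ℕ n → ℕ} → Recursive f → Recursiveᴸ (λ v → f v ∷ [])
singletonᴸ {f = f} rf = applyUpToᴸ (λ _ → f) (weakenʳ rf) (constantʳ 1)

++-applyUpTo : ∀ as bs →
  applyUpTo (λ i → cond (suc i ∸ length as) (nth as i) (nth bs (i ∸ length as)))
    (length as + length bs) ≡ as ++ bs
++-applyUpTo []       bs = applyUpTo-nth bs
++-applyUpTo (a ∷ as) bs = cong₂ _∷_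
  (cong (λ c → cond c a (nth bs (0 ∸ suc (length as)))) (0∸n≡0 (length as))) (++-applyUpTo as bs)

infixr 5 _++ᴸ_
_++ᴸ_ : ∀ {F G : Vec ℕ n → List ℕ} → Recursiveᴸ F → Recursiveᴸ G → Recursiveᴸ (λ v → F v ++ G v)
_++ᴸ_ {F = F} {G} rF rG = extᴸ (λ v → ++-applyUpTo (F v) (G v))
  (applyUpToᴸ (λ i v → cond (suc i ∸ length (F v)) (nth (F v) i) (nth (G v) (i ∸ length (F v))))
    (condʳ (monusʳ (successorʳ headʳ) (weakenʳ (lengthʳ rF))) (nthʳ (weakenᴸ rF) headʳ)
           (nthʳ (weakenᴸ rG) (monusʳ headʳ (weakenʳ (lengthʳ rF)))))
    (+ʳ (lengthʳ rF) (lengthʳ rG)))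

map-applyUpTo-nth : ∀ (f : ℕ → ℕ) as → applyUpTo (λ i → f (nth as i)) (length as) ≡ map f as
map-applyUpTo-nth f []       = refl
map-applyUpTo-nth f (a ∷ as) = cong (f a ∷_) (map-applyUpTo-nth f as)

mapᴸ : ∀ {f : ℕ → ℕ} {F : Vec ℕ n → List ℕ} → Recursive {1} (λ v → f (head v)) → Recursiveᴸ F →
  Recursiveᴸ (λ v → map f (F v))
mapᴸ {f = f} {F} rf rF = extᴸ (λ v → map-applyUpTo-nth f (F v))
  (applyUpToᴸ (λ i v → f (nth (F v) i)) (compositionʳ rf (nthʳ (weakenᴸ rF) headʳ ∷ [])) (lengthʳ rF))

drop-1-applyUpTo : ∀ as → applyUpTo (λ i → nth as (suc i)) (pred (length as)) ≡ drop 1 as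
drop-1-applyUpTo []       = refl
drop-1-applyUpTo (a ∷ as) = applyUpTo-nth as

drop-1ᴸ : ∀ {F : Vec ℕ n → List ℕ} → Recursiveᴸ F → Recursiveᴸ (λ v → drop 1 (F v))
drop-1ᴸ {F = F} rF = extᴸ (λ v → drop-1-applyUpTo (F v))
  (applyUpToᴸ (λ i v → nth (F v) (suc i)) (nthʳ (weakenᴸ rF) (successorʳ headʳ)) (predʳ (lengthʳ rF)))

condᴸ : ∀ {c : Vec ℕ n → ℕ} {F G : Vec ℕ n → List ℕ} → Recursive c → Recursiveᴸ F → Recursiveᴸ G →
  Recursiveᴸ (λ v → cond (c v) (F v) (G v))
condᴸ {c = c} rc rF rG =
  listʳ (ext (λ v → cond-map seqCode (c v)) (condʳ rc (codeʳ rF) (codeʳ rG)))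

-- Primitive recursion with lists as values.  The previous value is available to
-- the step only through its code, which the step decodes.
recursionᴸ : (F : ℕ → Vec ℕ n → List ℕ) (step : ℕ → List ℕ → Vec ℕ n → List ℕ)
  {base : Vec ℕ n → List ℕ} {N : Vec ℕ n → ℕ} →
  (∀ v → F 0 v ≡ base v) → (∀ i v → F (suc i) v ≡ step i (F i v) v) → Recursiveᴸ base →
  Recursiveᴸ (λ w → step (head w) (decode (head (tail w))) (tail (tail w))) →
  Recursive N → Recursiveᴸ (λ v → F (N v) v)
recursionᴸ F step F0 Fs rb rs rN = listʳ (recursionʳ (λ i v → seqCode (F i v))
  (λ i r v → seqCode (step i (decode r) v)) (λ v → cong seqCode (F0 v))
  (λ i v → cong seqCode (trans (Fs i v) (cong (λ s → step i s v) (sym (decode-seqCode (F i v))))))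
  (codeʳ rb) (codeʳ rs) rN)

skipᴸ : ∀ (f : ℕ → Vec ℕ n → List ℕ) → Recursiveᴸ (λ w → f (head w) (tail w)) →
  Recursiveᴸ (λ w → f (head w) (tail (tail w)))
skipᴸ f rf = listʳ (skipʳ (λ i v → seqCode (f i v)) (codeʳ rf))

concat-applyUpTo-suc : ∀ {A : Set} (f : ℕ → List A) n →
  concat (applyUpTo f (suc n)) ≡ concat (applyUpTo f n) ++ f n
concat-applyUpTo-suc f n = trans (cong concat (sym (applyUpTo-∷ʳ f n)))
  (trans (sym (concat-++ (applyUpTo f n) (f n ∷ [])))
         (cong (concat (applyUpTo f n) ++_) (++-identityʳ (f n))))

concatᴸ : ∀ (f : ℕ → Vec ℕ n → List ℕ) {N : Vec ℕ n → ℕ} → Recursiveᴸ (λ w → f (head w) (tail w)) →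
  Recursive N → Recursiveᴸ (λ v → concat (applyUpTo (λ i → f i v) (N v)))
concatᴸ f rf rN = recursionᴸ (λ n v → concat (applyUpTo (λ i → f i v) n)) (λ i s v → s ++ f i v)
  (λ _ → refl) (λ n v → concat-applyUpTo-suc (λ i → f i v) n) nilᴸ
  (decodeᴸ (weakenʳ headʳ) ++ᴸ skipᴸ f rf) rN

sum-applyUpTo-suc : ∀ (f : ℕ → ℕ) n → sum (applyUpTo f (suc n)) ≡ sum (applyUpTo f n) + f n
sum-applyUpTo-suc f n = trans (cong sum (sym (applyUpTo-∷ʳ f n)))
  (trans (sum-++ (applyUpTo f n) (f n ∷ [])) (cong (sum (applyUpTo f n) +_) (+-identityʳ (f n))))

sum-applyUpToʳ : ∀ (f : ℕ → Vec ℕ n → ℕ) {N : Vec ℕ n → ℕ} → Recursive (λ w → f (head w) (tail w)) →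
  Recursive N → Recursive (λ v → sum (applyUpTo (λ i → f i v) (N v)))
sum-applyUpToʳ f rf rN = recursionʳ (λ n v → sum (applyUpTo (λ i → f i v) n)) (λ i r v → r + f i v)
  (λ _ → refl) (λ n v → sum-applyUpTo-suc (λ i → f i v) n) zeroʳ (+ʳ (weakenʳ headʳ) (skipʳ f rf)) rN

sumʳ : ∀ {F : Vec ℕ n → List ℕ} → Recursiveᴸ F → Recursive (λ v → sum (F v))
sumʳ {F = F} rF = ext (λ v → cong sum (applyUpTo-nth (F v)))
  (sum-applyUpToʳ (λ i v → nth (F v) i) (nthʳ (weakenᴸ rF) headʳ) (lengthʳ rF))

-- The state of a left fold after i elements of the list, if there are as many.
foldl-iterate : ∀ (step : List ℕ → ℕ → List ℕ) → List ℕ → List ℕ → ℕ → List ℕ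
foldl-iterate step s as zero    = s
foldl-iterate step s as (suc i) = step (foldl-iterate step s as i) (nth as i)

foldl-iterate-∷ : ∀ step s a as i →
  foldl-iterate step s (a ∷ as) (suc i) ≡ foldl-iterate step (step s a) as i
foldl-iterate-∷ step s a as zero    = refl
foldl-iterate-∷ step s a as (suc i) = cong (λ s → step s (nth as i)) (foldl-iterate-∷ step s a as i)

foldl-iterate-length : ∀ step s as → foldl-iterate step s as (length as) ≡ foldl step s as
foldl-iterate-length step s []       = refl
foldl-iterate-length step s (a ∷ as) =
  trans (foldl-iterate-∷ step s a as (length as)) (foldl-iterate-length step (step s a) as)

foldlᴸ : ∀ (step : List ℕ → ℕ → List ℕ) s {F : Vec ℕ n → List ℕ} →
  (∀ {m} {S : Vec ℕ m → List ℕ} {e : Vec ℕ m → ℕ} → Recursiveᴸ S → Recursive e →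
     Recursiveᴸ (λ v → step (S v) (e v))) →
  Recursiveᴸ {n} (λ _ → s) → Recursiveᴸ F → Recursiveᴸ (λ v → foldl step s (F v))
foldlᴸ step s {F} rstep rs rF = extᴸ (λ v → foldl-iterate-length step s (F v))
  (recursionᴸ (λ i v → foldl-iterate step s (F v) i) (λ i s v → step s (nth (F v) i))
    (λ _ → refl) (λ _ _ → refl) rs
    (rstep (decodeᴸ (weakenʳ headʳ)) (nthʳ (weakenᴸ (weakenᴸ rF)) headʳ)) (lengthʳ rF))

-- Systems with numbered variables

module _ {R : Set} {L : Language R} where

  rename  : ∀ {a b} → (Fin a → Fin b) → Term L a → Term L b
  renames : ∀ {a b r} → (Fin a → Fin b) → Vec (Term L a) r → Vec (Term L b) r
  rename σ (var i)    = var (σ i)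
  rename σ (con c)    = con c
  rename σ (app f ts) = app f (renames σ ts)
  renames σ []        = []
  renames σ (t ∷ ts)  = rename σ t ∷ renames σ ts

  module _ {a b} (σ : Fin a → Fin b) (ρ : Vec R b) (ρ′ : Vec R a)
           (agree : ∀ i → lookup ρ (σ i) ≡ lookup ρ′ i) where

    eval-rename  : ∀ t → eval ρ (rename σ t) ≡ eval ρ′ t
    evals-rename : ∀ {r} (ts : Vec (Term L a) r) → evals ρ (renames σ ts) ≡ evals ρ′ ts
    eval-rename (var i)    = agree i
    eval-rename (con c)    = refl
    eval-rename (app f ts) = cong (Language.⟦_⟧ᶠ L f) (evals-rename ts)
    evals-rename []        = refl
    evals-rename (t ∷ ts)  = cong₂ _∷_ (eval-rename t) (evals-rename ts)

-- A basic formula whose variables are placed on the variables of a larger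
-- system, which are numbered from 0: the i-th variable of the formula stands
-- for the variable whose number is the i-th place.
record PlacedFormula {R : Set} (L : Language R) : Set where
  constructor _at_
  field
    {arity} : ℕ
    formula : BasicFormula L arity
    places  : Vec ℕ arity

lookup≤sum : ∀ {a} (is : Vec ℕ a) i → lookup is i ≤ Vec.sum is
lookup≤sum (j ∷ is) zero    = m≤m+n j _
lookup≤sum (j ∷ is) (suc i) = ≤-trans (lookup≤sum is i) (m≤n+m _ j)

toℕ-mod : ∀ {N} .{{_ : NonZero N}} {i} → i < N → toℕ (i mod N) ≡ i
toℕ-mod {N} {i} i<N = trans (toℕ-fromℕ< (m%n<n i N)) (m<n⇒m%n≡m i<N)

-- A vector of length N > 0 as a sequence; the values from N on are arbitrary and
-- are chosen by reduction modulo N.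
extend : {A : Set} → ∀ {N} .{{_ : NonZero N}} → Vec A N → ℕ → A
extend {N = N} xs i = lookup xs (i mod N)

module _ {R : Set} {L : Language R} where

  -- Truth of a placed formula under an assignment to all variable numbers.
  HoldsAt : (ℕ → R) → PlacedFormula L → Set
  HoldsAt ρ (φ at is) = Holds (Vec.map ρ is) φ

  renameFormula : ∀ {a b} → (Fin a → Fin b) → BasicFormula L a → BasicFormula L b
  renameFormula σ (rel S ts) = rel S (renames σ ts)

  -- A placed formula as a formula in N variables.  The places are meant to be less
  -- than N and are reduced modulo N otherwise.
  toFormula : ∀ N .{{_ : NonZero N}} → PlacedFormula L → BasicFormula L N
  toFormula N (φ at is) = renameFormula (λ i → lookup is i mod N) φ

  toSystem : ∀ N .{{_ : NonZero N}} → List (PlacedFormula L) → System L N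
  toSystem N = map (toFormula N)

  Holds-rename : ∀ {a b} (σ : Fin a → Fin b) (ρ : Vec R b) (ρ′ : Vec R a) →
    (∀ i → lookup ρ (σ i) ≡ lookup ρ′ i) → ∀ φ →
    (Holds ρ (renameFormula σ φ) → Holds ρ′ φ) × (Holds ρ′ φ → Holds ρ (renameFormula σ φ))
  Holds-rename σ ρ ρ′ agree (rel S ts) =
    subst (Language.⟦_⟧ʳ L S) (evals-rename σ ρ ρ′ agree ts) ,
    subst (Language.⟦_⟧ʳ L S) (sym (evals-rename σ ρ ρ′ agree ts))

  toSystem⁻ : ∀ {N} .{{_ : NonZero N}} (ρ : Vec R N) Φ →
    Solution (toSystem N Φ) ρ → All (HoldsAt (extend ρ)) Φ
  toSystem⁻ ρ []            []       = []
  toSystem⁻ ρ ((φ at is) ∷ Φ) (h ∷ hs) =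
    proj₁ (Holds-rename _ ρ _ (λ i → sym (lookup-map i (extend ρ) is)) φ) h ∷ toSystem⁻ ρ Φ hs

  -- No place in the system is greater than this number.
  bound : List (PlacedFormula L) → ℕ
  bound []              = 0
  bound ((φ at is) ∷ Φ) = Vec.sum is + bound Φ

  toSystem⁺ : ∀ {N} .{{_ : NonZero N}} (ρ : ℕ → R) Φ → bound Φ < N → All (HoldsAt ρ) Φ →
    Solution (toSystem N Φ) (tabulate (λ i → ρ (toℕ i)))
  toSystem⁺ ρ []              b<N []       = []
  toSystem⁺ {N} ρ ((φ at is) ∷ Φ) b<N (h ∷ hs) =
    proj₂ (Holds-rename _ (tabulate (λ i → ρ (toℕ i))) (Vec.map ρ is) agree φ) h ∷
    toSystem⁺ ρ Φ (≤-<-trans (m≤n+m _ (Vec.sum is)) b<N) hs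
    where
    agree : ∀ i → lookup (tabulate (λ i → ρ (toℕ i))) (lookup is i mod N) ≡ lookup (Vec.map ρ is) i
    agree i = begin
      lookup (tabulate (λ i → ρ (toℕ i))) (lookup is i mod N) ≡⟨ lookup∘tabulate _ (lookup is i mod N) ⟩
      ρ (toℕ (lookup is i mod N))
        ≡⟨ cong ρ (toℕ-mod (≤-<-trans (≤-trans (lookup≤sum is i) (m≤m+n _ _)) b<N)) ⟩
      ρ (lookup is i) ≡⟨ lookup-map i ρ is ⟨
      lookup (Vec.map ρ is) i ∎
      where open ≡-Reasoning

module _ {R : Set} {L : Language R} (ν : Numbering L) where
  open Numbering ν

  -- The symbol codes of a term whose variables are placed at given numbers.
  symbolsAt  : ∀ {k} → (Fin k → ℕ) → Term L k → List ℕ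
  symbolssAt : ∀ {k r} → (Fin k → ℕ) → Vec (Term L k) r → List ℕ
  symbolsAt is (var i)         = 3 ^ suc (is i) ∷ []
  symbolsAt is (con c)         = 2 ^ Injection.to num (inj₁ c) ∷ []
  symbolsAt is (app {r} f ts)  = 2 ^ Injection.to num (inj₂ (r , f)) ∷ symbolssAt is ts
  symbolssAt is []             = []
  symbolssAt is (t ∷ ts)       = symbolsAt is t ++ symbolssAt is ts

  -- The code that a placed formula has as a formula of a system with sufficiently
  -- many variables.
  placedCode : PlacedFormula L → List ℕ
  placedCode (rel {r} S ts at is) =
    Injection.to relNum (r , S) ∷ map (λ t → primePowers 0 (symbolsAt (lookup is) t)) (Vec.toList ts)

  symbols-rename  : ∀ {a b} (σ : Fin a → Fin b) (is : Fin a → ℕ) → (∀ i → toℕ (σ i) ≡ is i) →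
    ∀ t → symbols ν (rename σ t) ≡ symbolsAt is t
  symbolss-rename : ∀ {a b r} (σ : Fin a → Fin b) (is : Fin a → ℕ) → (∀ i → toℕ (σ i) ≡ is i) →
    ∀ (ts : Vec _ r) → symbolss ν (renames σ ts) ≡ symbolssAt is ts
  symbols-rename σ is eq (var i)    = cong (λ j → 3 ^ suc j ∷ []) (eq i)
  symbols-rename σ is eq (con c)    = refl
  symbols-rename σ is eq (app f ts) = cong (_ ∷_) (symbolss-rename σ is eq ts)
  symbolss-rename σ is eq []        = refl
  symbolss-rename σ is eq (t ∷ ts)  = cong₂ _++_ (symbols-rename σ is eq t) (symbolss-rename σ is eq ts)

  codes-rename : ∀ {a b r} (σ : Fin a → Fin b) (is : Fin a → ℕ) → (∀ i → toℕ (σ i) ≡ is i) →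
    ∀ (ts : Vec (Term L a) r) → map (J ν) (Vec.toList (renames σ ts)) ≡
      map (λ t → primePowers 0 (symbolsAt is t)) (Vec.toList ts)
  codes-rename σ is eq []       = refl
  codes-rename σ is eq (t ∷ ts) =
    cong₂ _∷_ (cong (primePowers 0) (symbols-rename σ is eq t)) (codes-rename σ is eq ts)

  formulaCode-toFormula : ∀ {N} .{{_ : NonZero N}} Φ → bound Φ < N →
    concatMap (formulaCode ν) (toSystem N Φ) ≡ concatMap placedCode Φ
  formulaCode-toFormula []                     b<N = refl
  formulaCode-toFormula ((rel S ts at is) ∷ Φ) b<N = cong₂ (λ xs ys → (_ ∷ xs) ++ ys)
    (codes-rename _ (lookup is)
      (λ i → toℕ-mod (≤-<-trans (≤-trans (lookup≤sum is i) (m≤m+n _ _)) b<N)) ts)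
    (formulaCode-toFormula Φ (≤-<-trans (m≤n+m _ (Vec.sum is)) b<N))

  systemCode-toSystem : ∀ {N} .{{_ : NonZero N}} Φ → bound Φ < N →
    systemCode ν (toSystem N Φ) ≡ length Φ ∷ concatMap placedCode Φ
  systemCode-toSystem Φ b<N = cong₂ _∷_ (length-map _ Φ) (formulaCode-toFormula Φ b<N)

  -- Symbol codes are positive, so that the code of a term is the Gödel number
  -- of the list of the predecessors of its symbol codes.
  symbolsAt-positive  : ∀ {k} (is : Fin k → ℕ) t → map suc (map pred (symbolsAt is t)) ≡ symbolsAt is t
  symbolssAt-positive : ∀ {k r} (is : Fin k → ℕ) (ts : Vec _ r) →
    map suc (map pred (symbolssAt is ts)) ≡ symbolssAt is ts
  symbolsAt-positive is (var i)    = cong (_∷ []) (suc-pred (3 ^ suc (is i)) {{m^n≢0 3 (suc (is i))}})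
  symbolsAt-positive is (con c)    = cong (_∷ []) (suc-pred (2 ^ e) {{m^n≢0 2 e}})
    where e = Injection.to num (inj₁ c)
  symbolsAt-positive is (app {r} f ts) =
    cong₂ _∷_ (suc-pred (2 ^ e) {{m^n≢0 2 e}}) (symbolssAt-positive is ts)
    where e = Injection.to num (inj₂ (r , f))
  symbolssAt-positive is []        = refl
  symbolssAt-positive is (t ∷ ts)  = begin
    map suc (map pred (symbolsAt is t ++ symbolssAt is ts))
      ≡⟨ cong (map suc) (map-++ pred (symbolsAt is t) _) ⟩
    map suc (map pred (symbolsAt is t) ++ map pred (symbolssAt is ts))
      ≡⟨ map-++ suc (map pred (symbolsAt is t)) _ ⟩
    map suc (map pred (symbolsAt is t)) ++ map suc (map pred (symbolssAt is ts))
      ≡⟨ cong₂ _++_ (symbolsAt-positive is t) (symbolssAt-positive is ts) ⟩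
    symbolsAt is t ++ symbolssAt is ts ∎
    where open ≡-Reasoning

  module _ {k} (is : Vec ℕ n → Fin k → ℕ) (ris : ∀ i → Recursive (λ v → is v i)) where

    symbolsAtᴸ  : ∀ t → Recursiveᴸ (λ v → map pred (symbolsAt (is v) t))
    symbolssAtᴸ : ∀ {r} (ts : Vec _ r) → Recursiveᴸ (λ v → map pred (symbolssAt (is v) ts))
    symbolsAtᴸ (var i)    = singletonᴸ (predʳ (^ʳ (constantʳ 3) (successorʳ (ris i))))
    symbolsAtᴸ (con c)    = singletonᴸ (constantʳ _)
    symbolsAtᴸ (app f ts) = singletonᴸ (constantʳ _) ++ᴸ symbolssAtᴸ ts
    symbolssAtᴸ []        = nilᴸ
    symbolssAtᴸ (t ∷ ts)  =
      extᴸ (λ v → sym (map-++ pred (symbolsAt (is v) t) _)) (symbolsAtᴸ t ++ᴸ symbolssAtᴸ ts)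

    termCodeʳ : ∀ t → Recursive (λ v → primePowers 0 (symbolsAt (is v) t))
    termCodeʳ t = ext (λ v → cong (primePowers 0) (symbolsAt-positive (is v) t)) (codeʳ (symbolsAtᴸ t))

    termCodesᴸ : ∀ {r} (ts : Vec _ r) →
      Recursiveᴸ (λ v → map (λ t → primePowers 0 (symbolsAt (is v) t)) (Vec.toList ts))
    termCodesᴸ []       = nilᴸ
    termCodesᴸ (t ∷ ts) = singletonᴸ (termCodeʳ t) ++ᴸ termCodesᴸ ts

  -- Recursive functions with systems as values, by way of the number of
  -- formulas and the concatenation of their codes, which make up the code of the
  -- system.
  record Recursiveˢ {n} (F : Vec ℕ n → List (PlacedFormula L)) : Set where
    constructor systemʳ
    field
      countʳ : Recursive (λ v → length (F v))
      codesᴸ : Recursiveᴸ (λ v → concatMap placedCode (F v))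
  open Recursiveˢ

  extˢ : ∀ {F G : Vec ℕ n → List (PlacedFormula L)} → (∀ v → F v ≡ G v) → Recursiveˢ F → Recursiveˢ G
  extˢ eq (systemʳ count codes) = systemʳ (ext (λ v → cong length (eq v)) count)
    (extᴸ (λ v → cong (concatMap placedCode) (eq v)) codes)

  nilˢ : Recursiveˢ {n} (λ _ → [])
  nilˢ = systemʳ zeroʳ nilᴸ

  infixr 5 _++ˢ_
  _++ˢ_ : ∀ {F G : Vec ℕ n → List (PlacedFormula L)} → Recursiveˢ F → Recursiveˢ G →
    Recursiveˢ (λ v → F v ++ G v)
  _++ˢ_ {F = F} {G} (systemʳ count₁ codes₁) (systemʳ count₂ codes₂) = systemʳ
    (ext (λ v → sym (length-++ (F v))) (+ʳ count₁ count₂))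
    (extᴸ (λ v → sym (concatMap-++ placedCode (F v) (G v))) (codes₁ ++ᴸ codes₂))

  condˢ : ∀ {c : Vec ℕ n → ℕ} {F G : Vec ℕ n → List (PlacedFormula L)} →
    Recursive c → Recursiveˢ F → Recursiveˢ G → Recursiveˢ (λ v → cond (c v) (F v) (G v))
  condˢ {c = c} rc (systemʳ count₁ codes₁) (systemʳ count₂ codes₂) = systemʳ
    (ext (λ v → cond-map length (c v)) (condʳ rc count₁ count₂))
    (extᴸ (λ v → cond-map (concatMap placedCode) (c v)) (condᴸ rc codes₁ codes₂))

  length-concat : ∀ {A : Set} (xss : List (List A)) → length (concat xss) ≡ sum (map length xss)
  length-concat []         = refl
  length-concat (xs ∷ xss) = trans (length-++ xs) (cong (length xs +_) (length-concat xss))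

  concatˢ : ∀ (f : ℕ → Vec ℕ n → List (PlacedFormula L)) {N : Vec ℕ n → ℕ} →
    Recursiveˢ (λ w → f (head w) (tail w)) → Recursive N →
    Recursiveˢ (λ v → concat (applyUpTo (λ i → f i v) (N v)))
  concatˢ f {N} (systemʳ count codes) rN = systemʳ
    (ext (λ v → sym (trans (length-concat (applyUpTo (λ i → f i v) (N v)))
                           (cong sum (map-applyUpTo (λ i → f i v) length (N v)))))
         (sum-applyUpToʳ (λ i v → length (f i v)) count rN))
    (extᴸ (λ v → sym (concatMap-concat (λ i → f i v) (N v)))
          (concatᴸ (λ i v → concatMap placedCode (f i v)) codes rN))
    where
    concatMap-concat : ∀ g N → concatMap placedCode (concat (applyUpTo g N)) ≡
      concat (applyUpTo (λ i → concatMap placedCode (g i)) N)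
    concatMap-concat g zero    = refl
    concatMap-concat g (suc N) = trans (concatMap-++ placedCode (g 0) _)
       (cong (concatMap placedCode (g 0) ++_) (concatMap-concat (λ i → g (suc i)) N))

  -- A fixed formula whose places are recursive functions.
  placedˢ : ∀ {a} (φ : BasicFormula L a) (is : Vec (Vec ℕ n → ℕ) a) → VecAll Recursive is →
    Recursiveˢ (λ v → (φ at Vec.map (λ i → i v) is) ∷ [])
  placedˢ (rel S ts) is ris = systemʳ (constantʳ 1)
    (extᴸ (λ v → sym (++-identityʳ _))
      (singletonᴸ (constantʳ _) ++ᴸ termCodesᴸ (λ v → lookup (Vec.map (λ i → i v) is))
        (λ i → ext (λ v → sym (lookup-map i (λ i → i v) is)) (lookup⁺ ris i)) ts))

  placedsˢ : ∀ {a} (T : System L a) (is : Vec (Vec ℕ n → ℕ) a) → VecAll Recursive is →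
    Recursiveˢ (λ v → map (_at Vec.map (λ i → i v) is) T)
  placedsˢ []      is ris = nilˢ
  placedsˢ (φ ∷ T) is ris = placedˢ φ is ris ++ˢ placedsˢ T is ris

-- Programs of the stack machine

^-cancelˡ : ∀ a → 1 < a → ∀ {i j} → a ^ i ≡ a ^ j → i ≡ j
^-cancelˡ a 1<a {i} {j} eq with <-cmp i j
... | tri< i<j _ _ = contradiction eq (<⇒≢ (^-monoʳ-< a 1<a i<j))
... | tri≈ _ i≡j _ = i≡j
... | tri> _ _ j<i = contradiction (sym eq) (<⇒≢ (^-monoʳ-< a 1<a j<i))

3^-odd : ∀ i → ∃ λ k → 3 ^ i ≡ suc (2 * k)
3^-odd zero    = 0 , refl
3^-odd (suc i) = let k , eq = 3^-odd i in suc (3 * k) , trans (cong (3 *_) eq) (lemma k)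
  where
  open +-*-Solver
  lemma : ∀ k → 3 * suc (2 * k) ≡ suc (2 * suc (3 * k))
  lemma = solve 1 (λ k → con 3 :* (con 1 :+ con 2 :* k) := con 1 :+ con 2 :* (con 1 :+ con 3 :* k)) refl

2^≢3^ : ∀ e i → 2 ^ e ≢ 3 ^ suc i
2^≢3^ zero    i eq with m^n≡1⇒n≡0∨m≡1 3 (suc i) (sym eq)
... | inj₁ ()
... | inj₂ ()
2^≢3^ (suc e) i eq = let k , odd = 3^-odd (suc i) in even≢odd (2 ^ e) k (trans eq odd)

∈-inverse : ∀ {A : Set} {n} (e : A ↔ Fin n) x → x ∈ List.tabulate (Inverse.from e)
∈-inverse e x =
  subst (_∈ List.tabulate (Inverse.from e)) (Inverse.strictlyInverseʳ e x) (∈-tabulate⁺ (Inverse.to e x))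

-- The operations of the stack machine.  An input or a constant is pushed; a
-- function replaces its arguments on top of the stack by its value; a relation
-- tests its arguments and replaces them by an arbitrary entry.
data Operation {R : Set} (L : Language R) : Set where
  input    : Operation L
  constant : Language.Con L → Operation L
  function : ∀ {r} → Language.Fun L r → Operation L
  relation : ∀ {r} → Language.Rel L r → Operation L

module _ {R : Set} {L : Language R} where

  -- The number of entries removed from the stack; one entry is always added.
  arity : Operation L → ℕ
  arity input            = 0
  arity (constant c)     = 0
  arity (function {r} f) = r
  arity (relation {r} S) = r

  -- The length of the tuples in the set that is associated with the operation.
  width : Operation L → ℕ
  width input            = 1
  width (constant c)     = 1
  width (function {r} f) = suc r
  width (relation {r} S) = r

  -- The entries that the operation relates, in the order of the associated set: a
  -- is the new top of the stack, and s is the stack before the operation.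
  cells : {A : Set} (o : Operation L) → A → (ℕ → A) → Vec A (width o)
  cells input        a s = a ∷ []
  cells (constant c) a s = a ∷ []
  cells (function f) a s = tabulate (λ j → s (toℕ j)) ∷ʳ a
  cells (relation S) a s = tabulate (λ j → s (toℕ j))

  map-cells : {A B : Set} (h : A → B) (o : Operation L) (a : A) (s : ℕ → A) →
    Vec.map h (cells o a s) ≡ cells o (h a) (λ j → h (s j))
  map-cells h input        a s = refl
  map-cells h (constant c) a s = refl
  map-cells h (function f) a s = trans (map-∷ʳ h a _) (cong (_∷ʳ h a) (sym (tabulate-∘ h _)))
  map-cells h (relation S) a s = sym (tabulate-∘ h _)

  cells-cong : {A : Set} (o : Operation L) {a b : A} {s t : ℕ → A} →
    a ≡ b → (∀ j → s j ≡ t j) → cells o a s ≡ cells o b t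
  cells-cong input        eq eqs = cong (_∷ []) eq
  cells-cong (constant c) eq eqs = cong (_∷ []) eq
  cells-cong (function f) eq eqs = cong₂ _∷ʳ_ (tabulate-cong (λ j → eqs (toℕ j))) eq
  cells-cong (relation S) eq eqs = tabulate-cong (λ j → eqs (toℕ j))

  All-cells : {A : Set} {P : A → Set} (o : Operation L) {a : A} {s : ℕ → A} →
    P a → (∀ j → P (s j)) → VecAll P (cells o a s)
  All-cells input        pa ps = pa ∷ []
  All-cells (constant c) pa ps = pa ∷ []
  All-cells {P = P} (function f) {a} {s} pa ps = snoc (tabulate⁺ (λ j → ps (toℕ j)))
    where
    snoc : ∀ {r} {xs : Vec _ r} → VecAll P xs → VecAll P (xs ∷ʳ a)
    snoc []         = pa ∷ []
    snoc (px ∷ pxs) = px ∷ snoc pxs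
  All-cells (relation S) pa ps = tabulate⁺ (λ j → ps (toℕ j))

  -- A list of all operations; this is where the finiteness of the language enters.
  operations : FiniteLanguage L → List (Operation L)
  operations ((_ , c) , (_ , f) , (_ , s)) = input ∷
    map constant (List.tabulate (Inverse.from c)) ++
    map (λ (_ , f) → function f) (List.tabulate (Inverse.from f)) ++
    map (λ (_ , S) → relation S) (List.tabulate (Inverse.from s))

  ∈-operations : (fin : FiniteLanguage L) → ∀ o → o ∈ operations fin
  ∈-operations fin input = here refl
  ∈-operations ((_ , c) , _) (constant x) = there (∈-++⁺ˡ (∈-map⁺ constant (∈-inverse c x)))
  ∈-operations ((_ , c) , (_ , f) , _) (function x) =
    there (∈-++⁺ʳ (map constant (List.tabulate (Inverse.from c)))
      (∈-++⁺ˡ (∈-map⁺ (λ (_ , f) → function f) (∈-inverse f (_ , x)))))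
  ∈-operations ((_ , c) , (_ , f) , (_ , s)) (relation x) =
    there (∈-++⁺ʳ (map constant (List.tabulate (Inverse.from c)))
          (∈-++⁺ʳ (map (λ (_ , f) → function f) (List.tabulate (Inverse.from f)))
                  (∈-map⁺ (λ (_ , S) → relation S) (∈-inverse s (_ , x)))))

-- Tokens are the numbers of the symbols in a program.  The tokens of variables,
-- constants and functions are twice their symbol codes, so that relations can have
-- odd tokens.  Variables are counted from 0 here.
varToken : ℕ → ℕ
varToken i = 2 * 3 ^ suc i

varToken-injective : ∀ {i j} → varToken i ≡ varToken j → i ≡ j
varToken-injective {i} {j} eq =
  suc-injective (^-cancelˡ 3 (s≤s (s≤s z≤n)) (*-cancelˡ-≡ (3 ^ suc i) (3 ^ suc j) 2 eq))

module _ {R : Set} {L : Language R} (ν : Numbering L) where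
  open Numbering ν

  -- The operation input stands for all variables and has an unused token.
  token : Operation L → ℕ
  token input            = 0
  token (constant c)     = 2 * 2 ^ Injection.to num (inj₁ c)
  token (function {r} f) = 2 * 2 ^ Injection.to num (inj₂ (r , f))
  token (relation {r} S) = suc (2 * Injection.to relNum (r , S))

  private
    power : Language.Con L ⊎ ∃ (Language.Fun L) → ℕ
    power x = 2 ^ Injection.to num x

    number : ∃ (Language.Rel L) → ℕ
    number = Injection.to relNum

  power-injective : ∀ {x y} → 2 * power x ≡ 2 * power y → x ≡ y
  power-injective {x} {y} eq =
    Injection.injective num (^-cancelˡ 2 (s≤s (s≤s z≤n)) (*-cancelˡ-≡ (power x) (power y) 2 eq))

  0≢power : ∀ x → 0 ≢ 2 * power x
  0≢power x eq = ≢-nonZero⁻¹ (2 ^ suc e) {{m^n≢0 2 (suc e)}} (sym eq)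
    where e = Injection.to num x

  power≢number : ∀ x y → 2 * power x ≢ suc (2 * number y)
  power≢number x y = even≢odd (power x) (number y)

  token-injective : Injective _≡_ _≡_ token
  token-injective {input}      {input}      eq = refl
  token-injective {input}      {constant c} eq = contradiction eq (0≢power (inj₁ c))
  token-injective {input}      {function f} eq = contradiction eq (0≢power (inj₂ (_ , f)))
  token-injective {constant c} {input}      eq = contradiction (sym eq) (0≢power (inj₁ c))
  token-injective {function f} {input}      eq = contradiction (sym eq) (0≢power (inj₂ (_ , f)))
  token-injective {constant c} {constant e} eq with power-injective {inj₁ c} {inj₁ e} eq
  ... | refl = refl
  token-injective {constant c} {function f} eq with power-injective {inj₁ c} {inj₂ (_ , f)} eq
  ... | ()
  token-injective {function f} {constant c} eq with power-injective {inj₂ (_ , f)} {inj₁ c} eq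
  ... | ()
  token-injective {function f} {function g} eq with power-injective {inj₂ (_ , f)} {inj₂ (_ , g)} eq
  ... | refl = refl
  token-injective {constant c} {relation S} eq = contradiction eq (power≢number (inj₁ c) (_ , S))
  token-injective {function f} {relation S} eq = contradiction eq (power≢number (inj₂ (_ , f)) (_ , S))
  token-injective {relation S} {constant c} eq = contradiction (sym eq) (power≢number (inj₁ c) (_ , S))
  token-injective {relation S} {function f} eq = contradiction (sym eq) (power≢number (inj₂ (_ , f)) (_ , S))
  token-injective {relation S} {relation U} eq
    with Injection.injective relNum (*-cancelˡ-≡ (number (_ , S)) (number (_ , U)) 2 (suc-injective eq))
  ... | refl = refl

  token≢varToken : ∀ o i → token o ≢ varToken i
  token≢varToken input        i eq =
    ≢-nonZero⁻¹ (2 * 3 ^ suc i) {{m*n≢0 2 (3 ^ suc i) {{_}} {{m^n≢0 3 (suc i)}}}} (sym eq)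
  token≢varToken (constant c) i eq =
    2^≢3^ (Injection.to num (inj₁ c)) i (*-cancelˡ-≡ (power (inj₁ c)) (3 ^ suc i) 2 eq)
  token≢varToken (function f) i eq =
    2^≢3^ (Injection.to num (inj₂ (_ , f))) i (*-cancelˡ-≡ (power (inj₂ (_ , f))) (3 ^ suc i) 2 eq)
  token≢varToken (relation S) i eq = even≢odd (3 ^ suc i) (number (_ , S)) (sym eq)

  -- Tokens that belong to no operation of the list are read as variables.
  find : List (Operation L) → ℕ → Operation L
  find []       t = input
  find (o ∷ os) t = cond (unequal (token o) t) o (find os t)

  find-token : ∀ {os o} → o ∈ os → find os (token o) ≡ o
  find-token {_ ∷ os} {o} (here refl) =
    cong (λ c → cond c o (find os (token o))) (unequal-refl (token o))
  find-token {o′ ∷ os} {o} (there o∈os) = cond-elim (_≡ o) (unequal (token o′) (token o))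
    (λ eq → token-injective (unequal≡0⇒≡ _ _ eq)) (λ _ → find-token o∈os)

  find-varToken : ∀ os i → find os (varToken i) ≡ input
  find-varToken []       i = refl
  find-varToken (o ∷ os) i = cond-elim (_≡ input) (unequal (token o) (varToken i))
    (λ eq → contradiction (unequal≡0⇒≡ _ _ eq) (token≢varToken o i)) (λ _ → find-varToken os i)

  -- The program of a term: its bracket-free prefix form.
  termTokens  : ∀ {k} → Term L k → List ℕ
  termsTokens : ∀ {k r} → Vec (Term L k) r → List ℕ
  termTokens (var i)    = varToken (toℕ i) ∷ []
  termTokens (con c)    = token (constant c) ∷ []
  termTokens (app f ts) = token (function f) ∷ termsTokens ts
  termsTokens []        = []
  termsTokens (t ∷ ts)  = termTokens t ++ termsTokens ts

  formulaTokens : ∀ {k} → BasicFormula L k → List ℕ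
  formulaTokens (rel S ts) = token (relation S) ∷ termsTokens ts

  -- As a relation leaves one more entry on the stack and the remaining entries in
  -- order, the programs of formulas can be concatenated.
  systemTokens : ∀ {k} → System L k → List ℕ
  systemTokens T = concatMap formulaTokens T

-- A vector as a sequence with the value a beyond its end.
pad : {R : Set} → R → ∀ {k} → Vec R k → ℕ → R
pad a []       i       = a
pad a (x ∷ xs) zero    = x
pad a (x ∷ xs) (suc i) = pad a xs i

pad-lookup : ∀ {R : Set} (a : R) {k} (xs : Vec R k) i → pad a xs (toℕ i) ≡ lookup xs i
pad-lookup a (x ∷ xs) zero    = refl
pad-lookup a (x ∷ xs) (suc i) = pad-lookup a xs i

Vec-map-injective : ∀ {A B : Set} {f : A → B} → Injective _≡_ _≡_ f →
  ∀ {n} {xs ys : Vec A n} → Vec.map f xs ≡ Vec.map f ys → xs ≡ ys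
Vec-map-injective inj {xs = []}     {[]}     eq = refl
Vec-map-injective inj {xs = x ∷ xs} {y ∷ ys} eq =
  let eq₁ , eq₂ = ∷-injective eq in cong₂ _∷_ (inj eq₁) (Vec-map-injective inj eq₂)

-- The translation

∈⇒≤sum : ∀ {x} {xs} → x ∈ xs → x ≤ sum xs
∈⇒≤sum {xs = x ∷ xs} (here refl) = m≤m+n x (sum xs)
∈⇒≤sum {xs = y ∷ xs} (there x∈xs) = ≤-trans (∈⇒≤sum x∈xs) (m≤n+m (sum xs) y)

-- The variable for the entry of the stack at height i and time p, where height 0
-- is the top, and the b-th auxiliary variable of time p.  Gödel numbers keep all
-- these variables apart, without bounds for i, p and b.  The variables 0, …, n are
-- reserved for the variables of the original system.
cell auxiliary : ℕ → ℕ → ℕ → ℕ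
cell      n p i = suc n + seqCode (0 ∷ p ∷ i ∷ [])
auxiliary n p b = suc n + seqCode (1 ∷ p ∷ b ∷ [])

-- The number i ≤ n of the variable with token t; if there is none, then the value
-- is still at most n.
inputIndex : ℕ → ℕ → ℕ
inputIndex n t = μ (λ i → unequal t (varToken i)) n

inputIndex≤ : ∀ n t → inputIndex n t ≤ n
inputIndex≤ n t = μ≤ (λ i → unequal t (varToken i)) n

inputIndex-varToken : ∀ {n i} → i ≤ n → inputIndex n (varToken i) ≡ i
inputIndex-varToken {n} {i} i≤n = μ-unique _ n i i≤n (unequal-refl (varToken i))
  λ j j<i eq → <⇒≢ j<i (sym (varToken-injective (unequal≡0⇒≡ _ _ eq)))

module _ {R₁ R₂ : Set} {L₁ : Language R₁} (d : R₁ → R₂) where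

  -- The set of tuples over R₂ that is associated with an operation: the graph of
  -- the operation or, for a relation, its extension, transported along d.
  Described : (o : Operation L₁) → Pred (Vec R₂ (width o)) 0ℓ
  Described input            v = ∃ λ x → v ≡ d x ∷ []
  Described (constant c)     v = v ≡ d (Language.⟦_⟧ᶜ L₁ c) ∷ []
  Described (function {r} f) v = ∃ λ (xs : Vec R₁ r) → v ≡ Vec.map d xs ∷ʳ d (Language.⟦_⟧ᶠ L₁ f xs)
  Described (relation S)       = image d (Language.⟦_⟧ʳ L₁ S)

-- In the following, os lists all operations for L₁, and for each of them a
-- description of the associated set is given.
module Translation {R₁ R₂ : Set} {L₁ : Language R₁} {L₂ : Language R₂} (ν₁ : Numbering L₁)
    (d : R₁ → R₂) (d-injective : Injective _≡_ _≡_ d)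
    (os : List (Operation L₁)) (complete : ∀ o → o ∈ os)
    (describe : (o : Operation L₁) → Diophantine L₂ (Described d o)) where

  auxiliaries : Operation L₁ → ℕ
  auxiliaries o = proj₁ (describe o)

  -- A system for the associated set.  Its first variables stand for the tuple, the
  -- others are auxiliary.
  description : ∀ o → System L₂ (width o + auxiliaries o)
  description o = proj₁ (proj₂ (describe o))

  maxArity : ℕ
  maxArity = sum (map arity os)

  arity≤maxArity : ∀ o → arity o ≤ maxArity
  arity≤maxArity o = ∈⇒≤sum (∈-map⁺ arity (complete o))

  equation : ℕ → ℕ → PlacedFormula L₂
  equation i j = rel (Language.eq L₂) (var zero ∷ var (suc zero) ∷ []) at (i ∷ j ∷ [])

  -- A pushed input is equal to the variable with the token t.
  link : Operation L₁ → ℕ → ℕ → ℕ → List (PlacedFormula L₂)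
  link input n p t = equation (cell n p 0) (inputIndex n t) ∷ []
  link _     n p t = []

  -- The entry at height i below the top is the one that was at height i below the
  -- removed entries.
  copies : Operation L₁ → ℕ → ℕ → ℕ → PlacedFormula L₂
  copies o n p i = equation (cell n p (suc i)) (cell n (suc p) (arity o + i))

  -- The variables to which the description of an operation at time p refers.
  places : ∀ o → ℕ → ℕ → Vec ℕ (width o + auxiliaries o)
  places o n p = cells o (cell n p 0) (cell n (suc p)) Vec.++ tabulate (λ b → auxiliary n p (toℕ b))

  -- The formulas for the token t at position p, read as the operation o.
  step : Operation L₁ → ℕ → ℕ → ℕ → List (PlacedFormula L₂)
  step o n p t =
    map (_at places o n p) (description o) ++ link o n p t ++ applyUpTo (copies o n p) (maxArity * p)

  -- The translation of a program whose first token has position p.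
  translation : ℕ → ℕ → List ℕ → List (PlacedFormula L₂)
  translation n p []       = []
  translation n p (t ∷ ts) = step (find ν₁ os t) n p t ++ translation n (suc p) ts

  -- For an input, the new entry a is the value b of the variable; for the other
  -- operations there is no condition.
  Linked : Operation L₁ → R₂ → R₂ → Set
  Linked input a b = a ≡ b
  Linked _     a b = ⊤

  -- The meaning of the formulas for one token: b entries are copied, and z is the
  -- value of the variable that the token may stand for.  The stack before the
  -- operation is called next, since it belongs to the next position.
  record Step (o : Operation L₁) (b : ℕ) (z : R₂) (current next : ℕ → R₂) : Set where
    field
      described : Described d o (cells o (current 0) next)
      linked    : Linked o (current 0) z
      copied    : ∀ {i} → i < b → current (suc i) ≡ next (arity o + i)

  module _ (ρ : ℕ → R₂) where

    equation⁻ : ∀ {i j} → HoldsAt ρ (equation i j) → ρ i ≡ ρ j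
    equation⁻ = Equivalence.to (Language.eq-equality L₂ _ _)

    equation⁺ : ∀ {i j} → ρ i ≡ ρ j → HoldsAt ρ (equation i j)
    equation⁺ = Equivalence.from (Language.eq-equality L₂ _ _)

    map-places : ∀ o n p → Vec.map ρ (places o n p) ≡
      cells o (ρ (cell n p 0)) (λ i → ρ (cell n (suc p) i)) Vec.++
      tabulate (λ b → ρ (auxiliary n p (toℕ b)))
    map-places o n p = trans (VecP.map-++ ρ (cells o _ _) _)
      (cong₂ Vec._++_ (map-cells ρ o _ _) (sym (tabulate-∘ ρ _)))

    step⁻ : ∀ o n p t → All (HoldsAt ρ) (step o n p t) →
      Step o (maxArity * p) (ρ (inputIndex n t)) (λ i → ρ (cell n p i)) (λ i → ρ (cell n (suc p) i))
    step⁻ o n p t hs = record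
      { described = proj₂ (proj₂ (proj₂ (describe o)))
          (_ , subst (Solution (description o)) (map-places o n p) (AllP.map⁻ (AllP.++⁻ˡ _ hs)))
      ; linked = linked o (AllP.++⁻ˡ _ (AllP.++⁻ʳ (map (_at places o n p) (description o)) hs))
      ; copied = λ i<b → equation⁻ (AllP.applyUpTo⁻ (copies o n p) _
          (AllP.++⁻ʳ (link o n p t) (AllP.++⁻ʳ (map (_at places o n p) (description o)) hs)) i<b)
      }
      where
      linked : ∀ o → All (HoldsAt ρ) (link o n p t) → Linked o (ρ (cell n p 0)) (ρ (inputIndex n t))
      linked input        (h ∷ []) = equation⁻ h
      linked (constant _) _        = tt
      linked (function _) _        = tt
      linked (relation _) _        = tt

    step⁺ : ∀ o n p t →
      Step o (maxArity * p) (ρ (inputIndex n t)) (λ i → ρ (cell n p i)) (λ i → ρ (cell n (suc p) i)) →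
      Solution (description o) (cells o (ρ (cell n p 0)) (λ i → ρ (cell n (suc p) i)) Vec.++
                                tabulate (λ b → ρ (auxiliary n p (toℕ b)))) →
      All (HoldsAt ρ) (step o n p t)
    step⁺ o n p t h solution = AllP.++⁺
      (AllP.map⁺ (subst (Solution (description o)) (sym (map-places o n p)) solution))
      (AllP.++⁺ (links o (Step.linked h))
        (AllP.applyUpTo⁺₁ (copies o n p) _ λ i<b → equation⁺ (Step.copied h i<b)))
      where
      links : ∀ o → Linked o (ρ (cell n p 0)) (ρ (inputIndex n t)) → All (HoldsAt ρ) (link o n p t)
      links input        eq = equation⁺ eq ∷ []
      links (constant _) _  = []
      links (function _) _  = []
      links (relation _) _  = []

  -- Soundness of the translation

  -- Every token of the program takes the stack u (p + 1) to u p, as far as the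
  -- translation expresses this; z is the assignment to the input variables.
  Trace : ℕ → (ℕ → R₂) → (ℕ → ℕ → R₂) → ℕ → List ℕ → Set
  Trace n z u p []       = ⊤
  Trace n z u p (t ∷ ts) =
    Step (find ν₁ os t) (maxArity * p) (z (inputIndex n t)) (u p) (u (suc p)) × Trace n z u (suc p) ts

  translation⁻ : ∀ ρ n p ts → All (HoldsAt ρ) (translation n p ts) →
    Trace n ρ (λ p i → ρ (cell n p i)) p ts
  translation⁻ ρ n p []       hs = tt
  translation⁻ ρ n p (t ∷ ts) hs = step⁻ ρ (find ν₁ os t) n p t (AllP.++⁻ˡ _ hs) ,
    translation⁻ ρ n (suc p) ts (AllP.++⁻ʳ (step (find ν₁ os t) n p t) hs)

  module Soundness {n : ℕ} {z : ℕ → R₂} {u : ℕ → ℕ → R₂} where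

    StepAt : Operation L₁ → R₂ → ℕ → Set
    StepAt o a p = Step o (maxArity * p) a (u p) (u (suc p))

    operation-step : ∀ o {ts} p → Trace n z u p (token ν₁ o ∷ ts) →
      StepAt o (z (inputIndex n (token ν₁ o))) p
    operation-step o p (h , _) = subst (λ o′ → StepAt o′ _ p) (find-token ν₁ (complete o)) h

    variable-step : ∀ {i ts} p → i ≤ n → Trace n z u p (varToken i ∷ ts) → StepAt input (z i) p
    variable-step {i} p i≤n (h , _) =
      subst₂ (λ o j → StepAt o (z j) p) (find-varToken ν₁ os i) (inputIndex-varToken i≤n) h

    -- Here the description of d(R₁) is used: the values of all input variables that
    -- the program pushes belong to d(R₁).
    inputs-sound : ∀ is {rest} p → All (_≤ n) is → Trace n z u p (map varToken is ++ rest) →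
      All (λ i → ∃ λ x → z i ≡ d x) is × ∃ λ p′ → Trace n z u p′ rest
    inputs-sound []       p []           tr = [] , p , tr
    inputs-sound (i ∷ is) p (i≤n ∷ is≤n) tr =
      let h = variable-step p i≤n tr
          x , eq = Step.described h
          xs , tr′ = inputs-sound is (suc p) is≤n (proj₂ tr)
      in (x , trans (sym (Step.linked h)) (proj₁ (∷-injective eq))) ∷ xs , tr′

    module _ {k} (x : Vec R₁ k) (k≤1+n : k ≤ suc n) (z≡dx : ∀ i → z (toℕ i) ≡ d (lookup x i)) where

      -- If the program of a term extends from position p to position p′, then the
      -- stack at time p consists of the image of the value on top of the stack at
      -- time p′, as far as entries are copied at time p.
      term-sound : ∀ t {rest} p → Trace n z u p (termTokens ν₁ t ++ rest) → ∃ λ p′ →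
        p ≤ p′ × Trace n z u p′ rest × u p 0 ≡ d (eval x t) ×
        (∀ {i} → i < maxArity * p → u p (suc i) ≡ u p′ i)
      terms-sound : ∀ {r} (ts : Vec (Term L₁ k) r) {rest} p → r ≤ maxArity * p →
        Trace n z u p (termsTokens ν₁ ts ++ rest) → ∃ λ p′ →
        p ≤ p′ × Trace n z u p′ rest × tabulate (λ j → u p (toℕ j)) ≡ Vec.map d (evals x ts) ×
        (∀ {i} → r + i ≤ maxArity * p → u p (r + i) ≡ u p′ i)
      term-sound (var i) p tr =
        let h = variable-step p (s≤s⁻¹ (≤-trans (toℕ<n i) k≤1+n)) tr
        in suc p , n≤1+n p , proj₂ tr , trans (Step.linked h) (z≡dx i) , Step.copied h
      term-sound (con c) p tr =
        let h = operation-step (constant c) p tr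
        in suc p , n≤1+n p , proj₂ tr , proj₁ (∷-injective (Step.described h)) , Step.copied h
      term-sound (app {r} f ts) p tr =
        let h = operation-step (function f) p tr
            r≤ = ≤-trans (arity≤maxArity (function f)) (m≤m*n maxArity (suc p))
            p′ , p<p′ , tr′ , args , rest = terms-sound ts (suc p) r≤ (proj₂ tr)
            xs , eq = Step.described h
            eq₁ , eq₂ = ∷ʳ-injective (tabulate (λ j → u (suc p) (toℕ j))) (Vec.map d xs) eq
            xs≡ = Vec-map-injective d-injective (trans (sym eq₁) args)
        in p′ , <⇒≤ p<p′ , tr′ , trans eq₂ (cong (λ xs → d (Language.⟦_⟧ᶠ L₁ f xs)) xs≡) ,
           λ i< → trans (Step.copied h i<)
             (rest (≤-trans (+-mono-≤ (arity≤maxArity (function f)) (<⇒≤ i<))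
                            (≤-reflexive (sym (*-suc maxArity p)))))
      terms-sound [] p _ tr = p , ≤-refl , tr , refl , λ _ → refl
      terms-sound {suc r} (t ∷ ts) p r≤ tr =
        let p₁ , p≤p₁ , tr₁ , head≡ , tail≡ = term-sound t p
              (subst (Trace n z u p) (++-assoc (termTokens ν₁ t) (termsTokens ν₁ ts) _) tr)
            A*p≤ = *-monoʳ-≤ maxArity p≤p₁
            p₂ , p₁≤p₂ , tr₂ , args , rest = terms-sound ts p₁ (≤-trans (<⇒≤ r≤) A*p≤) tr₁
        in p₂ , ≤-trans p≤p₁ p₁≤p₂ , tr₂ ,
           cong₂ _∷_ head≡ (trans (tabulate-cong (λ j → tail≡ (<-≤-trans (toℕ<n j) (<⇒≤ r≤)))) args) ,
           λ i≤ → trans (tail≡ i≤) (rest (≤-trans (<⇒≤ i≤) A*p≤))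

      formula-sound : ∀ φ {rest} p → Trace n z u p (formulaTokens ν₁ φ ++ rest) →
        Holds x φ × ∃ λ p′ → Trace n z u p′ rest
      formula-sound (rel S ts) p tr =
        let h = operation-step (relation S) p tr
            r≤ = ≤-trans (arity≤maxArity (relation S)) (m≤m*n maxArity (suc p))
            p′ , _ , tr′ , args , _ = terms-sound ts (suc p) r≤ (proj₂ tr)
            xs , S-xs , eq = Step.described h
            xs≡ = Vec-map-injective d-injective (trans (sym eq) args)
        in subst (Language.⟦_⟧ʳ L₁ S) xs≡ S-xs , p′ , tr′

      system-sound : ∀ T p → Trace n z u p (systemTokens ν₁ T) → Solution T x
      system-sound []      p tr = []
      system-sound (φ ∷ T) p tr =
        let φ-holds , p′ , tr′ = formula-sound φ p tr in φ-holds ∷ system-sound T p′ tr′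

  -- Completeness of the translation

  0₁ : R₁
  0₁ = Language.⟦_⟧ᶜ L₁ (Language.𝟘 L₁)

  module Completeness {k : ℕ} (x : Vec R₁ k) (n : ℕ) where

    -- The values of the input variables; those beyond the k variables of the system
    -- are arbitrary.
    X : ℕ → R₁
    X = pad 0₁ x

    -- The entry that an operation pushes, for an input a and the stack s.
    result : Operation L₁ → R₁ → (ℕ → R₁) → R₁
    result input        a s = a
    result (constant c) a s = Language.⟦_⟧ᶜ L₁ c
    result (function f) a s = Language.⟦_⟧ᶠ L₁ f (tabulate (λ j → s (toℕ j)))
    result (relation S) a s = 0₁

    -- The stack after the run of a program over R₁, from an initial stack all of whose
    -- entries are 0.
    stack : List ℕ → ℕ → R₁
    stack []       i       = 0₁
    stack (t ∷ ts) zero    = result (find ν₁ os t) (X (inputIndex n t)) (stack ts)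
    stack (t ∷ ts) (suc i) = stack ts (arity (find ν₁ os t) + i)

    -- All tests of the run succeed; for operations other than relations, the
    -- condition always holds.
    Valid : List ℕ → Set
    Valid []       = ⊤
    Valid (t ∷ ts) =
      Described d (find ν₁ os t)
        (cells (find ν₁ os t) (d (stack (t ∷ ts) 0)) (λ i → d (stack ts i))) × Valid ts

    operation-stack : ∀ o ts →
      stack (token ν₁ o ∷ ts) 0 ≡ result o (X (inputIndex n (token ν₁ o))) (stack ts) ×
      (∀ i → stack (token ν₁ o ∷ ts) (suc i) ≡ stack ts (arity o + i))
    operation-stack o ts rewrite find-token ν₁ (complete o) = refl , λ _ → refl

    variable-stack : ∀ {i} ts → i ≤ n → stack (varToken i ∷ ts) 0 ≡ X i ×
      (∀ j → stack (varToken i ∷ ts) (suc j) ≡ stack ts j)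
    variable-stack {i} ts i≤n rewrite find-varToken ν₁ os i | inputIndex-varToken i≤n = refl , λ _ → refl

    -- If the operation is a relation, then it holds for the top entries of s.
    Test : Operation L₁ → (ℕ → R₁) → Set
    Test o s = ∀ {r} (S : Language.Rel L₁ r) → o ≡ relation S →
      Language.⟦_⟧ʳ L₁ S (tabulate (λ j → s (toℕ j)))

    described : ∀ o a s → Test o s →
      Described d o (cells o (d (result o a s)) (λ i → d (s i)))
    described input        a s h = a , refl
    described (constant c) a s h = refl
    described (function f) a s h = _ ,
      cong (_∷ʳ d (result (function f) a s)) (tabulate-∘ d (λ j → s (toℕ j)))
    described (relation S) a s h = _ , h S refl , tabulate-∘ d (λ j → s (toℕ j))

    operation-valid : ∀ o {ts} → Test o (stack ts) → Valid ts → Valid (token ν₁ o ∷ ts)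
    operation-valid o {ts} h valid =
      described _ _ _ (λ S eq → h S (trans (sym (find-token ν₁ (complete o))) eq)) , valid

    variable-valid : ∀ i {ts} → Valid ts → Valid (varToken i ∷ ts)
    variable-valid i {ts} valid =
      described _ _ _ (λ S eq → contradiction (trans (sym (find-varToken ν₁ os i)) eq) λ ()) , valid

    inputs-valid : ∀ is {ts} → Valid ts → Valid (map varToken is ++ ts)
    inputs-valid []       valid = valid
    inputs-valid (i ∷ is) valid = variable-valid i (inputs-valid is valid)

    term-valid  : ∀ (t : Term L₁ k) {rest} → Valid rest → Valid (termTokens ν₁ t ++ rest)
    terms-valid : ∀ {r} (ts : Vec (Term L₁ k) r) {rest} → Valid rest → Valid (termsTokens ν₁ ts ++ rest)
    term-valid (var i)    valid = variable-valid (toℕ i) valid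
    term-valid (con c)    valid = operation-valid (constant c) (λ _ ()) valid
    term-valid (app f ts) valid = operation-valid (function f) (λ _ ()) (terms-valid ts valid)
    terms-valid []        valid = valid
    terms-valid (t ∷ ts)  valid =
      subst Valid (sym (++-assoc (termTokens ν₁ t) (termsTokens ν₁ ts) _))
        (term-valid t (terms-valid ts valid))

    module _ (k≤1+n : k ≤ suc n) where

      term-stack  : ∀ (t : Term L₁ k) rest → stack (termTokens ν₁ t ++ rest) 0 ≡ eval x t ×
        (∀ i → stack (termTokens ν₁ t ++ rest) (suc i) ≡ stack rest i)
      terms-stack : ∀ {r} (ts : Vec (Term L₁ k) r) rest →
        tabulate (λ j → stack (termsTokens ν₁ ts ++ rest) (toℕ j)) ≡ evals x ts ×
        (∀ i → stack (termsTokens ν₁ ts ++ rest) (r + i) ≡ stack rest i)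
      term-stack (var i) rest =
        let eq₀ , eqₛ = variable-stack rest (s≤s⁻¹ (≤-trans (toℕ<n i) k≤1+n))
        in trans eq₀ (pad-lookup 0₁ x i) , eqₛ
      term-stack (con c) rest = operation-stack (constant c) rest
      term-stack (app f ts) rest =
        let eq₀ , eqₛ = operation-stack (function f) (termsTokens ν₁ ts ++ rest)
            args , tail≡ = terms-stack ts rest
        in trans eq₀ (cong (Language.⟦_⟧ᶠ L₁ f) args) , λ i → trans (eqₛ i) (tail≡ i)
      terms-stack [] rest = refl , λ _ → refl
      terms-stack (t ∷ ts) rest rewrite ++-assoc (termTokens ν₁ t) (termsTokens ν₁ ts) rest =
        let head≡ , tail≡ = term-stack t (termsTokens ν₁ ts ++ rest)
            args , rest≡ = terms-stack ts rest
        in cong₂ _∷_ head≡ (trans (tabulate-cong (λ j → tail≡ (toℕ j))) args) ,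
           λ i → trans (tail≡ _) (rest≡ i)

      system-valid : ∀ T → Solution T x → Valid (systemTokens ν₁ T)
      system-valid []              []       = tt
      system-valid (rel S ts ∷ T) (h ∷ hs) = operation-valid (relation S)
        (λ { _ refl → subst (Language.⟦_⟧ʳ L₁ S) (sym (proj₁ (terms-stack ts (systemTokens ν₁ T)))) h })
        (terms-valid ts (system-valid T hs))

    witness : ∀ o {v} → Described d o v → ∃ λ ys → Solution (description o) (v Vec.++ ys)
    witness o = proj₁ (proj₂ (proj₂ (describe o)))

    -- The values of the auxiliary variables, taken from the descriptions.
    auxiliaryValue : ∀ ts → Valid ts → ℕ → ℕ → R₂
    auxiliaryValue []       valid       p       b = d 0₁
    auxiliaryValue (t ∷ ts) (h , _)     zero    b = pad (d 0₁) (proj₁ (witness (find ν₁ os t) h)) b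
    auxiliaryValue (t ∷ ts) (_ , valid) (suc p) b = auxiliaryValue ts valid p b

    -- Every assignment that agrees with the run satisfies the translation.  The
    -- tokens ts are those from position p on.
    translation⁺ : ∀ ρ p ts (valid : Valid ts) →
      (∀ {i} → i ≤ n → ρ i ≡ d (X i)) →
      (∀ q i → ρ (cell n (q + p) i) ≡ d (stack (drop q ts) i)) →
      (∀ q b → ρ (auxiliary n (q + p) b) ≡ auxiliaryValue ts valid q b) →
      All (HoldsAt ρ) (translation n p ts)
    translation⁺ ρ p []       valid       input≡ cell≡ aux≡ = []
    translation⁺ ρ p (t ∷ ts) (h , valid) input≡ cell≡ aux≡ = AllP.++⁺
      (step⁺ ρ o n p t
        (record { described = subst (Described d o) cells≡ h
                ; linked = linked
                ; copied = λ {i} _ → trans (cell≡ 0 (suc i)) (sym (cell≡ 1 (arity o + i))) })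
        (subst (Solution (description o)) (cong₂ Vec._++_ cells≡ aux-vector) (proj₂ (witness o h))))
      (translation⁺ ρ (suc p) ts valid input≡
        (λ q i → trans (cong (λ p → ρ (cell n p i)) (+-suc q p)) (cell≡ (suc q) i))
        (λ q b → trans (cong (λ p → ρ (auxiliary n p b)) (+-suc q p)) (aux≡ (suc q) b)))
      where
      o = find ν₁ os t
      cells≡ : cells o (d (stack (t ∷ ts) 0)) (λ i → d (stack ts i)) ≡
               cells o (ρ (cell n p 0)) (λ i → ρ (cell n (suc p) i))
      cells≡ = cells-cong o (sym (cell≡ 0 0)) (λ i → sym (cell≡ 1 i))
      aux-vector : proj₁ (witness o h) ≡ tabulate (λ b → ρ (auxiliary n p (toℕ b)))
      aux-vector = trans (sym (tabulate∘lookup _))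
        (tabulate-cong (λ b → sym (trans (aux≡ 0 (toℕ b)) (pad-lookup (d 0₁) (proj₁ (witness o h)) b))))
      link≡ : ∀ o → o ≡ find ν₁ os t → Linked o (ρ (cell n p 0)) (ρ (inputIndex n t))
      link≡ (constant c) _  = tt
      link≡ (function f) _  = tt
      link≡ (relation S) _  = tt
      link≡ input        eq = begin
        ρ (cell n p 0)        ≡⟨ cell≡ 0 0 ⟩
        d (stack (t ∷ ts) 0)  ≡⟨ cong (λ o → d (result o (X (inputIndex n t)) (stack ts))) (sym eq) ⟩
        d (X (inputIndex n t)) ≡⟨ input≡ (inputIndex≤ n t) ⟨
        ρ (inputIndex n t)    ∎
        where open ≡-Reasoning
      linked = link≡ o refl

    module _ (ts : List ℕ) (valid : Valid ts) where

      -- The value of the variable suc n + c in terms of the list with code c.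
      value : List ℕ → R₂
      value (zero  ∷ p ∷ i ∷ []) = d (stack (drop p ts) i)
      value (suc _ ∷ p ∷ b ∷ []) = auxiliaryValue ts valid p b
      value _                    = d 0₁

      -- The assignment that describes the run of the program ts.
      assignment : ℕ → R₂
      assignment i = cond (i ∸ n) (d (X i)) (value (decode (i ∸ suc n)))

      assignment-input : ∀ {i} → i ≤ n → assignment i ≡ d (X i)
      assignment-input {i} i≤n =
        cong (λ c → cond c (d (X i)) (value (decode (i ∸ suc n)))) (m≤n⇒m∸n≡0 i≤n)

      assignment-code : ∀ as → assignment (suc n + seqCode as) ≡ value as
      assignment-code as = begin
        cond (suc n + c ∸ n) a (value (decode (suc n + c ∸ suc n)))
          ≡⟨ cong₂ (λ e c → cond e a (value (decode c)))
                   (trans (cong (_∸ n) (sym (+-suc n c))) (m+n∸m≡n n (suc c))) (m+n∸m≡n (suc n) c) ⟩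
        value (decode c) ≡⟨ cong value (decode-seqCode as) ⟩
        value as ∎
        where
        open ≡-Reasoning
        c = seqCode as
        a = d (X (suc n + c))

      assignment-solution : All (HoldsAt assignment) (translation n 0 ts)
      assignment-solution = translation⁺ assignment 0 ts valid assignment-input
        (λ q i → trans (assignment-code (0 ∷ q + 0 ∷ i ∷ []))
                       (cong (λ q → d (stack (drop q ts) i)) (+-identityʳ q)))
        (λ q b → trans (assignment-code (1 ∷ q + 0 ∷ b ∷ []))
                       (cong (λ q → auxiliaryValue ts valid q b) (+-identityʳ q)))

  -- The program of a system is preceded by tokens that push the inputs 0, …, n, so
  -- that also variables that do not occur in the system get values in d(R₁).
  program : ∀ {k} → ℕ → System L₁ k → List ℕ
  program n T = map varToken (upTo (suc n)) ++ systemTokens ν₁ T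

  translate : ∀ {k} → ℕ → System L₁ k → List (PlacedFormula L₂)
  translate n T = translation n 0 (program n T)

  translate-complete : ∀ n {k} (T : System L₁ k) (x : Vec R₁ k) → k ≤ suc n → Solution T x →
    ∃ λ ρ → All (HoldsAt ρ) (translate n T) × ∀ i → ρ (toℕ i) ≡ d (lookup x i)
  translate-complete n T x k≤1+n T-x =
    assignment (program n T) valid , assignment-solution (program n T) valid ,
    λ i → trans (assignment-input (program n T) valid (s≤s⁻¹ (≤-trans (toℕ<n i) k≤1+n)))
                (cong d (pad-lookup 0₁ x i))
    where
    open Completeness x n
    valid = inputs-valid (upTo (suc n)) (system-valid k≤1+n T T-x)

  translate-sound : ∀ n {k} (T : System L₁ k) → k ≤ suc n → ∀ ρ → All (HoldsAt ρ) (translate n T) →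
    ∃ λ (x : Vec R₁ k) → Solution T x × ∀ i → ρ (toℕ i) ≡ d (lookup x i)
  translate-sound n {k} T k≤1+n ρ hs = x , system-sound x k≤1+n ρ≡ T p tr , ρ≡
    where
    open Soundness
    inputs = inputs-sound (upTo (suc n)) 0 (AllP.applyUpTo⁺₁ id (suc n) s≤s⁻¹)
      (translation⁻ ρ n 0 (program n T) hs)
    p = proj₁ (proj₂ inputs)
    tr = proj₂ (proj₂ inputs)
    preimage : ∀ (i : Fin k) → ∃ λ a → ρ (toℕ i) ≡ d a
    preimage i = All.lookup (proj₁ inputs) (∈-upTo⁺ (≤-trans (toℕ<n i) k≤1+n))
    x = tabulate (λ i → proj₁ (preimage i))
    ρ≡ : ∀ i → ρ (toℕ i) ≡ d (lookup x i)
    ρ≡ i = trans (proj₂ (preimage i)) (cong d (sym (lookup∘tabulate _ i)))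

-- Diophantine maps

tabulate-++ : ∀ {A : Set} (f : ℕ → A) k l →
  tabulate {n = k + l} (λ i → f (toℕ i)) ≡
    tabulate {n = k} (λ i → f (toℕ i)) Vec.++ tabulate {n = l} (λ i → f (k + toℕ i))
tabulate-++ f zero    l = refl
tabulate-++ f (suc k) l = cong (f 0 ∷_) (tabulate-++ (λ i → f (suc i)) k l)

extend-++ˡ : ∀ {A : Set} {k l} .{{_ : NonZero (k + l)}} (z : Vec A k) (y : Vec A l) i →
  extend (z Vec.++ y) (toℕ i) ≡ lookup z i
extend-++ˡ {k = k} {l} z y i = trans
  (cong (lookup (z Vec.++ y)) (toℕ-injective
    (trans (toℕ-mod (≤-trans (toℕ<n i) (m≤m+n k l))) (sym (toℕ-↑ˡ i l)))))
  (lookup-++ˡ z y i)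

lookup-injective : ∀ {A : Set} {k} (xs ys : Vec A k) → (∀ i → lookup xs i ≡ lookup ys i) → xs ≡ ys
lookup-injective xs ys eq =
  trans (sym (tabulate∘lookup xs)) (trans (tabulate-cong eq) (tabulate∘lookup ys))

module _ {R₁ R₂ : Set} {L₁ : Language R₁} {L₂ : Language R₂} (ν₁ : Numbering L₁)
    (d : R₁ → R₂) (d-injective : Injective _≡_ _≡_ d)
    (os : List (Operation L₁)) (complete : ∀ o → o ∈ os)
    (describe : (o : Operation L₁) → Diophantine L₂ (Described d o)) where
  open Translation {L₂ = L₂} ν₁ d d-injective os complete describe

  -- The system that defines S has l quantified variables, which join the auxiliary
  -- variables of its translation.
  diophantineMap : DiophantineMap L₁ L₂ d
  diophantineMap k S (l , T , S⊂ , ⊃S) = l + suc b , toSystem N Φ , to , from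
    where
    Φ = translate (k + l) T
    b = bound Φ
    N = k + (l + suc b)
    b<N : b < N
    b<N = ≤-trans (m≤n+m (suc b) l) (m≤n+m (l + suc b) k)
    instance
      N≢0 : NonZero N
      N≢0 = >-nonZero (≤-<-trans z≤n b<N)
    to : ∀ {v} → image d S v → ∃ λ ys → Solution (toSystem N Φ) (v Vec.++ ys)
    to (xs , S-xs , refl) =
      let ys , T-xs = S⊂ S-xs
          ρ , hs , ρ≡ = translate-complete (k + l) T (xs Vec.++ ys) (n≤1+n (k + l)) T-xs
          v≡ = lookup-injective (tabulate (λ i → ρ (toℕ i))) (Vec.map d xs) λ i → begin
            lookup (tabulate (λ i → ρ (toℕ i))) i ≡⟨ lookup∘tabulate _ i ⟩
            ρ (toℕ i) ≡⟨ cong ρ (toℕ-↑ˡ i l) ⟨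
            ρ (toℕ (i ↑ˡ l)) ≡⟨ ρ≡ (i ↑ˡ l) ⟩
            d (lookup (xs Vec.++ ys) (i ↑ˡ l)) ≡⟨ cong d (lookup-++ˡ xs ys i) ⟩
            d (lookup xs i) ≡⟨ lookup-map i d xs ⟨
            lookup (Vec.map d xs) i ∎
          zs = tabulate (λ j → ρ (k + toℕ j))
      in zs ,
         subst (Solution (toSystem N Φ)) (trans (tabulate-++ ρ k (l + suc b)) (cong (Vec._++ zs) v≡))
               (toSystem⁺ ρ Φ b<N hs)
      where open ≡-Reasoning
    from : ∀ {v} → (∃ λ ys → Solution (toSystem N Φ) (v Vec.++ ys)) → image d S v
    from {v} (ys , hs) =
      let x , T-x , ρ≡ = translate-sound (k + l) T (n≤1+n (k + l)) (extend (v Vec.++ ys))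
            (toSystem⁻ (v Vec.++ ys) Φ hs)
          xs , xs′ , x≡ = Vec.splitAt k x
      in xs , ⊃S (xs′ , subst (Solution T) x≡ T-x) , lookup-injective v (Vec.map d xs) λ i → begin
           lookup v i ≡⟨ extend-++ˡ v ys i ⟨
           extend (v Vec.++ ys) (toℕ i) ≡⟨ cong (extend (v Vec.++ ys)) (toℕ-↑ˡ i l) ⟨
           extend (v Vec.++ ys) (toℕ (i ↑ˡ l)) ≡⟨ ρ≡ (i ↑ˡ l) ⟩
           d (lookup x (i ↑ˡ l)) ≡⟨ cong (λ x → d (lookup x (i ↑ˡ l))) x≡ ⟩
           d (lookup (xs Vec.++ xs′) (i ↑ˡ l)) ≡⟨ cong d (lookup-++ˡ xs xs′ i) ⟩
           d (lookup xs i) ≡⟨ lookup-map i d xs ⟨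
           lookup (Vec.map d xs) i ∎
      where open ≡-Reasoning

  -- The translation as a system in the k variables of the original system and
  -- l others.  Since l is arbitrary, it may be any number that makes all places
  -- less than k + l.
  translate-system : ∀ n {k} (T : System L₁ k) → k ≤ suc n → ∃ λ l → Σ (System L₂ (k + l)) λ DT →
    (∀ (ν₂ : Numbering L₂) →
       length (translate n T) ∷ concatMap (placedCode ν₂) (translate n T) ≡ systemCode ν₂ DT) ×
    (∀ (x : Vec R₁ k) → Solution T x → ∃ λ (y : Vec R₂ l) → Solution DT (Vec.map d x Vec.++ y)) ×
    (∀ (z : Vec R₂ k) (y : Vec R₂ l) → Solution DT (z Vec.++ y) →
       ∃ λ (x : Vec R₁ k) → Solution T x × z ≡ Vec.map d x)
  translate-system n {k} T k≤1+n =
    suc b , toSystem N Φ , (λ ν₂ → sym (systemCode-toSystem ν₂ Φ b<N)) , to , from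
    where
    Φ = translate n T
    b = bound Φ
    N = k + suc b
    b<N : b < N
    b<N = m≤n+m (suc b) k
    instance
      N≢0 : NonZero N
      N≢0 = >-nonZero (≤-<-trans z≤n b<N)
    to : ∀ x → Solution T x → ∃ λ y → Solution (toSystem N Φ) (Vec.map d x Vec.++ y)
    to x T-x =
      let ρ , hs , ρ≡ = translate-complete n T x k≤1+n T-x
          z≡ = lookup-injective (tabulate (λ i → ρ (toℕ i))) (Vec.map d x) λ i →
            trans (lookup∘tabulate _ i) (trans (ρ≡ i) (sym (lookup-map i d x)))
          y = tabulate (λ j → ρ (k + toℕ j))
      in y ,
         subst (Solution (toSystem N Φ)) (trans (tabulate-++ ρ k (suc b)) (cong (Vec._++ y) z≡))
               (toSystem⁺ ρ Φ b<N hs)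
    from : ∀ z y → Solution (toSystem N Φ) (z Vec.++ y) → ∃ λ x → Solution T x × z ≡ Vec.map d x
    from z y hs =
      let x , T-x , ρ≡ = translate-sound n T k≤1+n (extend (z Vec.++ y)) (toSystem⁻ (z Vec.++ y) Φ hs)
      in x , T-x , lookup-injective z (Vec.map d x) λ i →
           trans (sym (extend-++ˡ z y i)) (trans (ρ≡ i) (sym (lookup-map i d x)))

-- Scanning the code of a system

module _ {R : Set} {L : Language R} (ν : Numbering L) where

  symbols≡symbolsAt  : ∀ {k} (t : Term L k) → symbols ν t ≡ symbolsAt ν toℕ t
  symbolss≡symbolssAt : ∀ {k r} (ts : Vec (Term L k) r) → symbolss ν ts ≡ symbolssAt ν toℕ ts
  symbols≡symbolsAt (var i)    = refl
  symbols≡symbolsAt (con c)    = refl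
  symbols≡symbolsAt (app f ts) = cong (_ ∷_) (symbolss≡symbolssAt ts)
  symbolss≡symbolssAt []       = refl
  symbolss≡symbolssAt (t ∷ ts) = cong₂ _++_ (symbols≡symbolsAt t) (symbolss≡symbolssAt ts)

  termTokens≡  : ∀ {k} (t : Term L k) → termTokens ν t ≡ map (2 *_) (symbols ν t)
  termsTokens≡ : ∀ {k r} (ts : Vec (Term L k) r) → termsTokens ν ts ≡ map (2 *_) (symbolss ν ts)
  termTokens≡ (var i)    = refl
  termTokens≡ (con c)    = refl
  termTokens≡ (app f ts) = cong (_ ∷_) (termsTokens≡ ts)
  termsTokens≡ []        = refl
  termsTokens≡ (t ∷ ts)  =
    trans (cong₂ _++_ (termTokens≡ t) (termsTokens≡ ts))
          (sym (map-++ (2 *_) (symbols ν t) (symbolss ν ts)))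

  -- The program of the term with number e.  As symbol codes are positive, decoding
  -- yields their predecessors.
  decodedTokens : ℕ → List ℕ
  decodedTokens e = map (λ x → 2 * suc x) (decode e)

  decodedTokens-J : ∀ {k} (t : Term L k) → decodedTokens (J ν t) ≡ termTokens ν t
  decodedTokens-J t = begin
    map (λ x → 2 * suc x) (decode (J ν t))
      ≡⟨ cong (λ ss → map (λ x → 2 * suc x) (decode (primePowers 0 ss))) (sym positive) ⟩
    map (λ x → 2 * suc x) (decode (seqCode (map pred ss)))
      ≡⟨ cong (map (λ x → 2 * suc x)) (decode-seqCode (map pred ss)) ⟩
    map (λ x → 2 * suc x) (map pred ss) ≡⟨ map-∘ (map pred ss) ⟩
    map (2 *_) (map suc (map pred ss)) ≡⟨ cong (map (2 *_)) positive ⟩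
    map (2 *_) ss ≡⟨ termTokens≡ t ⟨
    termTokens ν t ∎
    where
    open ≡-Reasoning
    ss = symbols ν t
    positive : map suc (map pred ss) ≡ ss
    positive =
      subst (λ ss → map suc (map pred ss) ≡ ss) (sym (symbols≡symbolsAt t)) (symbolsAt-positive ν toℕ t)

  occurs⇒∈  : ∀ {k} {i : Fin k} {t : Term L k} → Occurs i t → varToken (toℕ i) ∈ termTokens ν t
  occurss⇒∈ : ∀ {k r} {i : Fin k} {ts : Vec (Term L k) r} → VecAny (Occurs i) ts →
    varToken (toℕ i) ∈ termsTokens ν ts
  occurs⇒∈ here       = here refl
  occurs⇒∈ (arg i∈ts) = there (occurss⇒∈ i∈ts)
  occurss⇒∈ {ts = t ∷ ts} (VecAny.here i∈t)   = ∈-++⁺ˡ (occurs⇒∈ i∈t)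
  occurss⇒∈ {ts = t ∷ ts} (VecAny.there i∈ts) = ∈-++⁺ʳ (termTokens ν t) (occurss⇒∈ i∈ts)

  occursInSystem⇒∈ : ∀ {k} {i : Fin k} {T : System L k} →
    Any (OccursInFormula i) T → varToken (toℕ i) ∈ systemTokens ν T
  occursInSystem⇒∈ {T = rel S ts ∷ T} (here i∈φ)  = there (∈-++⁺ˡ (occurss⇒∈ i∈φ))
  occursInSystem⇒∈ {T = φ ∷ T}        (there i∈T) = ∈-++⁺ʳ (formulaTokens ν φ) (occursInSystem⇒∈ i∈T)

  -- The condition on the last variable bounds the number of variables by a
  -- number that can be computed from the program.
  variables≤sum : ∀ {k} (T : System L k) → LastVariableOccurs T → k ≤ suc (sum (systemTokens ν T))
  variables≤sum {zero}  T last = z≤n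
  variables≤sum {suc k} T last = s≤s (begin
    k                       ≤⟨ n≤1+n k ⟩
    suc k                   ≤⟨ <⇒≤ (n<m^n (s≤s (s≤s z≤n)) (suc k)) ⟩
    3 ^ suc k               ≤⟨ m≤m+n (3 ^ suc k) _ ⟩
    varToken k              ≡⟨ cong varToken (toℕ-fromℕ k) ⟨
    varToken (toℕ (fromℕ k)) ≤⟨ ∈⇒≤sum (occursInSystem⇒∈ (last (fromℕ k) (cong suc (toℕ-fromℕ k)))) ⟩
    sum (systemTokens ν T)  ∎)
    where open ≤-Reasoning

  -- The code of a system is scanned from left to right.  The state is a list: the
  -- number of terms to be read before the next relation, followed by the tokens
  -- produced so far.
  scan : List (Operation L) → List ℕ → ℕ → List ℕ
  scan os s e = cond (nth s 0)
    (arity (find ν os (suc (2 * e))) ∷ drop 1 s ++ suc (2 * e) ∷ [])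
    (pred (nth s 0) ∷ drop 1 s ++ decodedTokens e)

  scan-terms : ∀ os {k r} (ts : Vec (Term L k) r) out es →
    foldl (scan os) (r ∷ out) (map (J ν) (Vec.toList ts) ++ es) ≡
    foldl (scan os) (0 ∷ out ++ termsTokens ν ts) es
  scan-terms os []       out es =
    cong (λ out → foldl (scan os) (0 ∷ out) es) (sym (++-identityʳ out))
  scan-terms os {r = suc r} (t ∷ ts) out es = begin
    foldl (scan os) (r ∷ out ++ decodedTokens (J ν t)) (map (J ν) (Vec.toList ts) ++ es)
      ≡⟨ cong (λ xs → foldl (scan os) (r ∷ out ++ xs) (map (J ν) (Vec.toList ts) ++ es))
              (decodedTokens-J t) ⟩
    foldl (scan os) (r ∷ out ++ termTokens ν t) (map (J ν) (Vec.toList ts) ++ es)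
      ≡⟨ scan-terms os ts (out ++ termTokens ν t) es ⟩
    foldl (scan os) (0 ∷ (out ++ termTokens ν t) ++ termsTokens ν ts) es
      ≡⟨ cong (λ out → foldl (scan os) (0 ∷ out) es) (++-assoc out (termTokens ν t) _) ⟩
    foldl (scan os) (0 ∷ out ++ termTokens ν t ++ termsTokens ν ts) es ∎
    where open ≡-Reasoning

  scan-system : ∀ os → (∀ o → o ∈ os) → ∀ {k} (T : System L k) out →
    foldl (scan os) (0 ∷ out) (concatMap (formulaCode ν) T) ≡ 0 ∷ out ++ systemTokens ν T
  scan-system os complete []              out = cong (0 ∷_) (sym (++-identityʳ out))
  scan-system os complete (rel {r} S ts ∷ T) out = begin
    foldl (scan os) (arity (find ν os t) ∷ out ++ t ∷ []) es
      ≡⟨ cong (λ o → foldl (scan os) (arity o ∷ out ++ t ∷ []) es)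
              (find-token ν (complete (relation S))) ⟩
    foldl (scan os) (r ∷ out ++ t ∷ []) es
      ≡⟨ scan-terms os ts (out ++ t ∷ []) _ ⟩
    foldl (scan os) (0 ∷ (out ++ t ∷ []) ++ termsTokens ν ts) (concatMap (formulaCode ν) T)
      ≡⟨ scan-system os complete T _ ⟩
    0 ∷ ((out ++ t ∷ []) ++ termsTokens ν ts) ++ systemTokens ν T
      ≡⟨ cong (0 ∷_) (trans (cong (_++ systemTokens ν T) (++-assoc out (t ∷ []) _))
                             (++-assoc out (t ∷ termsTokens ν ts) _)) ⟩
    0 ∷ out ++ (t ∷ termsTokens ν ts) ++ systemTokens ν T ∎
    where
    open ≡-Reasoning
    t = token ν (relation S)
    es = map (J ν) (Vec.toList ts) ++ concatMap (formulaCode ν) T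

  -- The number of formulas at the head of the code is not needed.
  scannedTokens : List (Operation L) → List ℕ → List ℕ
  scannedTokens os as = drop 1 (foldl (scan os) (0 ∷ []) (drop 1 as))

  scannedTokens-systemCode : ∀ os → (∀ o → o ∈ os) → ∀ {k} (T : System L k) →
    scannedTokens os (systemCode ν T) ≡ systemTokens ν T
  scannedTokens-systemCode os complete T = cong (drop 1) (scan-system os complete T [])

  arity-findʳ : ∀ os {t : Vec ℕ n → ℕ} → Recursive t → Recursive (λ v → arity (find ν os (t v)))
  arity-findʳ []       rt = zeroʳ
  arity-findʳ (o ∷ os) {t} rt = ext (λ v → cond-map arity (unequal (token ν o) (t v)))
    (condʳ (unequalʳ (constantʳ (token ν o)) rt) (constantʳ (arity o)) (arity-findʳ os rt))

  scanᴸ : ∀ os {S : Vec ℕ n → List ℕ} {e : Vec ℕ n → ℕ} → Recursiveᴸ S → Recursive e →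
    Recursiveᴸ (λ v → scan os (S v) (e v))
  scanᴸ os rS re = condᴸ (nthʳ rS zeroʳ)
    (singletonᴸ (arity-findʳ os odd) ++ᴸ drop-1ᴸ rS ++ᴸ singletonᴸ odd)
    (singletonᴸ (predʳ (nthʳ rS zeroʳ)) ++ᴸ drop-1ᴸ rS ++ᴸ
      mapᴸ (*ʳ (constantʳ 2) (successorʳ headʳ)) (decodeᴸ re))
    where odd = successorʳ (*ʳ (constantʳ 2) re)

  scannedTokensᴸ : ∀ os {F : Vec ℕ n → List ℕ} → Recursiveᴸ F → Recursiveᴸ (λ v → scannedTokens os (F v))
  scannedTokensᴸ os rF = drop-1ᴸ (foldlᴸ (scan os) (0 ∷ []) (scanᴸ os) (singletonᴸ zeroʳ) (drop-1ᴸ rF))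

-- Recursiveness of the translation

module _ {R₁ R₂ : Set} {L₁ : Language R₁} {L₂ : Language R₂} (ν₁ : Numbering L₁) (ν₂ : Numbering L₂)
    (d : R₁ → R₂) (d-injective : Injective _≡_ _≡_ d)
    (os : List (Operation L₁)) (complete : ∀ o → o ∈ os)
    (describe : (o : Operation L₁) → Diophantine L₂ (Described d o)) where
  open Translation {L₂ = L₂} ν₁ d d-injective os complete describe

  stepAt : ℕ → ℕ → ℕ → List (PlacedFormula L₂)
  stepAt n p t = step (find ν₁ os t) n p t

  -- The translation processes each position independently of the others.
  translation-applyUpTo : ∀ n p ts →
    concat (applyUpTo (λ q → stepAt n (q + p) (nth ts q)) (length ts)) ≡ translation n p ts
  translation-applyUpTo n p []       = refl
  translation-applyUpTo n p (t ∷ ts) = cong (stepAt n p t ++_)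
    (trans (cong concat (applyUpTo-cong
             (λ q → cong (λ p → stepAt n p (nth ts q)) (sym (+-suc q p))) (length ts)))
           (translation-applyUpTo n (suc p) ts))

  -- The translation on codes.  The sum of the tokens serves as the last input
  -- variable n.
  codeTranslation : List ℕ → List ℕ
  codeTranslation as = length Φ ∷ concatMap (placedCode ν₂) Φ
    where
    ts = scannedTokens ν₁ os as
    Φ = translation (sum ts) 0 (map varToken (upTo (suc (sum ts))) ++ ts)

  codeTranslation-systemCode : ∀ {k} (T : System L₁ k) → let Φ = translate (sum (systemTokens ν₁ T)) T in
    codeTranslation (systemCode ν₁ T) ≡ length Φ ∷ concatMap (placedCode ν₂) Φ
  codeTranslation-systemCode T = cong
    (λ ts → let Φ = translation (sum ts) 0 (map varToken (upTo (suc (sum ts))) ++ ts)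
            in length Φ ∷ concatMap (placedCode ν₂) Φ)
    (scannedTokens-systemCode ν₁ os complete T)

  varTokenʳ : ∀ {i : Vec ℕ n → ℕ} → Recursive i → Recursive (λ v → varToken (i v))
  varTokenʳ ri = *ʳ (constantʳ 2) (^ʳ (constantʳ 3) (successorʳ ri))

  module _ {n p : Vec ℕ m → ℕ} (rn : Recursive n) (rp : Recursive p) where

    cellʳ : ∀ {i : Vec ℕ m → ℕ} → Recursive i → Recursive (λ v → cell (n v) (p v) (i v))
    cellʳ ri = +ʳ (successorʳ rn) (codeʳ (singletonᴸ zeroʳ ++ᴸ singletonᴸ rp ++ᴸ singletonᴸ ri))

    auxiliaryʳ : ∀ {b : Vec ℕ m → ℕ} → Recursive b → Recursive (λ v → auxiliary (n v) (p v) (b v))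
    auxiliaryʳ rb = +ʳ (successorʳ rn)
      (codeʳ (singletonᴸ (constantʳ 1) ++ᴸ singletonᴸ rp ++ᴸ singletonᴸ rb))

  equationˢ : ∀ {i j : Vec ℕ n → ℕ} → Recursive i → Recursive j →
    Recursiveˢ ν₂ (λ v → equation (i v) (j v) ∷ [])
  equationˢ {i = i} {j} ri rj = placedˢ ν₂ _ (i ∷ j ∷ []) (ri ∷ rj ∷ [])

  module _ {n p t : Vec ℕ m → ℕ} (rn : Recursive n) (rp : Recursive p) (rt : Recursive t) where

    linkˢ : ∀ o → Recursiveˢ ν₂ (λ v → link o (n v) (p v) (t v))
    linkˢ (constant c) = nilˢ ν₂
    linkˢ (function f) = nilˢ ν₂
    linkˢ (relation S) = nilˢ ν₂
    linkˢ input        = equationˢ (cellʳ rn rp zeroʳ)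
      (μʳ {g = λ i v → unequal (t v) (varToken i)} (unequalʳ (weakenʳ rt) (varTokenʳ headʳ)) rn)

    concat-singletons : ∀ {A : Set} (f : ℕ → A) N → concat (applyUpTo (λ i → f i ∷ []) N) ≡ applyUpTo f N
    concat-singletons f zero    = refl
    concat-singletons f (suc N) = cong (f 0 ∷_) (concat-singletons (λ i → f (suc i)) N)

    copiesˢ : ∀ o → Recursiveˢ ν₂ (λ v → applyUpTo (copies o (n v) (p v)) (maxArity * p v))
    copiesˢ o = extˢ ν₂ (λ v → concat-singletons (copies o (n v) (p v)) (maxArity * p v))
      (concatˢ ν₂ (λ i v → copies o (n v) (p v) i ∷ [])
        (equationˢ (cellʳ (weakenʳ rn) (weakenʳ rp) (successorʳ headʳ))
                   (cellʳ (weakenʳ rn) (successorʳ (weakenʳ rp)) (+ʳ (constantʳ (arity o)) headʳ)))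
        (*ʳ (constantʳ maxArity) rp))

    -- For a fixed operation, only the places in the description vary.
    stepˢ : ∀ o → Recursiveˢ ν₂ (λ v → step o (n v) (p v) (t v))
    stepˢ o = _++ˢ_ ν₂
      (extˢ ν₂ (λ v → cong (λ is → map (_at is) (description o)) (map-placeFunctions v))
            (placedsˢ ν₂ (description o) placeFunctions placeFunctionsʳ))
      (_++ˢ_ ν₂ (linkˢ o) (copiesˢ o))
      where
      placeFunctions : Vec (Vec ℕ m → ℕ) (width o + auxiliaries o)
      placeFunctions = cells o (λ v → cell (n v) (p v) 0) (λ i v → cell (n v) (suc (p v)) i) Vec.++
        tabulate (λ b v → auxiliary (n v) (p v) (toℕ b))
      map-placeFunctions : ∀ v → Vec.map (λ f → f v) placeFunctions ≡ places o (n v) (p v)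
      map-placeFunctions v = trans (VecP.map-++ (λ f → f v) (cells o _ _) _)
        (cong₂ Vec._++_ (map-cells (λ f → f v) o _ _) (sym (tabulate-∘ (λ f → f v) _)))
      placeFunctionsʳ : VecAll Recursive placeFunctions
      placeFunctionsʳ = ++⁺
        (All-cells o (cellʳ rn rp zeroʳ) (λ i → cellʳ rn (successorʳ rp) (constantʳ i)))
        (tabulate⁺ (λ b → auxiliaryʳ rn rp (constantʳ (toℕ b))))

    -- The operation found for a token is one of finitely many.
    step-findˢ : ∀ os → Recursiveˢ ν₂ (λ v → step (find ν₁ os (t v)) (n v) (p v) (t v))
    step-findˢ []       = stepˢ input
    step-findˢ (o ∷ os) = extˢ ν₂
      (λ v → cond-map (λ o → step o (n v) (p v) (t v)) (unequal (token ν₁ o) (t v)))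
      (condˢ ν₂ (unequalʳ (constantʳ (token ν₁ o)) rt) (stepˢ o) (step-findˢ os))

  translationˢ : ∀ {n : Vec ℕ m → ℕ} {ts : Vec ℕ m → List ℕ} → Recursive n → Recursiveᴸ ts →
    Recursiveˢ ν₂ (λ v → translation (n v) 0 (ts v))
  translationˢ {n = n} {ts} rn rts = extˢ ν₂ (λ v → translation-applyUpTo (n v) 0 (ts v))
    (concatˢ ν₂ (λ q v → stepAt (n v) (q + 0) (nth (ts v) q))
      (step-findˢ (weakenʳ rn) (+ʳ headʳ zeroʳ) (nthʳ (weakenᴸ rts) headʳ) os) (lengthʳ rts))

  codeTranslationᴸ : ∀ {F : Vec ℕ n → List ℕ} → Recursiveᴸ F → Recursiveᴸ (λ v → codeTranslation (F v))
  codeTranslationᴸ {F = F} rF = singletonᴸ (Recursiveˢ.countʳ rΦ) ++ᴸ Recursiveˢ.codesᴸ rΦ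
    where
    rts = scannedTokensᴸ ν₁ os rF
    rn  = sumʳ rts
    rΦ = translationˢ rn (mapᴸ (varTokenʳ headʳ) (applyUpToᴸ (λ i _ → i) headʳ (successorʳ rn)) ++ᴸ rts)

  codeTranslation-recursive : RecursiveOnLists codeTranslation
  codeTranslation-recursive = (λ v → seqCode (codeTranslation (decode (head v)))) ,
    codeʳ (codeTranslationᴸ (decodeᴸ headʳ)) ,
    λ as → cong (λ as → seqCode (codeTranslation as)) (decode-seqCode as)

  effective : Effective ν₁ ν₂ d
  effective = codeTranslation , codeTranslation-recursive , λ T last →
    let l , DT , code , to , from =
          translate-system ν₁ d d-injective os complete describe
            (sum (systemTokens ν₁ T)) T (variables≤sum ν₁ T last)
    in l , DT , trans (codeTranslation-systemCode T) (code ν₂) , to , from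

theorem1p8 : {R₁ R₂ : Set} (L₁ : Language R₁) (L₂ : Language R₂) →
    FiniteLanguage L₁ → FiniteLanguage L₂ →
    HilbertTenthExists L₁ → HilbertTenthExists L₂ →
    (ν₁ : Numbering L₁) (ν₂ : Numbering L₂) →
    (d : R₁ → R₂) → Injective _≡_ _≡_ d →
    (∀ (c : Language.Con L₁) →
      Diophantine L₂ (λ v → v ≡ d (Language.⟦_⟧ᶜ L₁ c) ∷ [])) →
    (∀ {k} (f : Language.Fun L₁ k) →
      Diophantine L₂ (λ v → ∃ λ (xs : Vec R₁ k) → v ≡ Vec.map d xs ∷ʳ d (Language.⟦_⟧ᶠ L₁ f xs))) →
    (∀ {k} (S : Language.Rel L₁ k) →
      Diophantine L₂ (image d (Language.⟦_⟧ʳ L₁ S))) →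
    Diophantine L₂ (λ v → ∃ λ (x : R₁) → v ≡ d x ∷ []) →
    DiophantineMap L₁ L₂ d × Effective ν₁ ν₂ d
theorem1p8 L₁ L₂ finite₁ _ _ _ ν₁ ν₂ d d-injective constants functions relations range =
  diophantineMap ν₁ d d-injective os complete describe ,
  effective ν₁ ν₂ d d-injective os complete describe
  where
  os = operations finite₁
  complete = ∈-operations finite₁
  describe : ∀ o → Diophantine L₂ (Described d o)
  describe input        = range
  describe (constant c) = constants c
  describe (function f) = functions f
  describe (relation S) = relations S
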